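{- Let $\lambda/\mu$ and $\nu/\rho$ be skew shapes, where $\lambda,\mu,\nu,\rho$ are written as sequences of the same length $\ell$ (partitions padded with zeros). Let $T$ be a $(\lambda/\mu)\circledast(\nu/\rho)$-peelable tableau and let $T'=\operatorname{BK}_1\circ\operatorname{BK}_3\circ\cdots\circ\operatorname{BK}_{2\ell-1}(T)$. Then $T'$ is a $(\nu/\rho)\circledast(\lambda/\mu)$-peelable tableau, and $T$ and $T'$ have the same shape.
   Context: Young diagrams are in English convention: $(i,j)$ is row $i$ (numbered top to bottom), column $j$. For skew shapes $\alpha/\beta$ and $\gamma/\delta$, the shuffle diagram $D$ of shape $(\alpha/\beta)\circledast(\gamma/\delta)$ has a square at $(2i-1,2j-1)$ for each square $(i,j)$ of $\alpha/\beta$ and a square at $(2i,2j)$ for each square $(i,j)$ of $\gamma/\delta$. For $i\ge1$ let $a_i$ be the number of columns of $D$ containing a square in row $i$ and a square in row $i+2$. A $D$-peelable (also called $(\alpha/\beta)\circledast(\gamma/\delta)$-peelable) tableau is a semistandard Young tableau $T$ of some partition shape whose content is $(\alpha_1-\beta_1,\gamma_1-\delta_1,\alpha_2-\beta_2,\gamma_2-\delta_2,\ldots)$ (number of entries $r$ equals number of squares in row $r$ of $D$), such that for every $i\ge 1$ there are at least $a_i$ pairwise disjoint pairs (square containing $i$, square containing $i+2$) with the $i$-square Northeast of the $(i+2)$-square (in a row weakly above and a column weakly to the right). The Bender--Knuth involution $\operatorname{BK}_i$ on semistandard Young tableaux of a fixed shape is defined as follows: let $S$ be the set of squares of $T$ containing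 $i$ or $i+1$; in each row of $S$ there are, from left to right, $a$ entries $i$ lying directly above an $i+1$, then $b$ entries $i$ alone in their column (within $S$), then $c$ entries $i+1$ alone in their column, then $d$ entries $i+1$ lying directly below an $i$; replace, in every row, the $b+c$ free entries by $c$ entries $i$ followed by $b$ entries $i+1$, leaving everything else unchanged. This produces a semistandard tableau $\operatorname{BK}_i(T)$ of the same shape with the numbers of $i$'s and $(i+1)$'s exchanged. -}

module Defs where

open import Data.Nat using (ℕ; zero; suc; _+_; _*_; _∸_; _≤_; _<_; _<ᵇ_; _≤ᵇ_; _≡ᵇ_)
open import Data.Bool using (Bool; true; false; if_then_else_; _∧_; not)
open import Data.Maybe using (Maybe; just; nothing)
open import Data.List using (List; []; _∷_; length; map)
open import Data.Nat.ListAction using (sum)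
open import Data.Vec using (Vec; lookup; toList)
open import Data.Fin using (Fin)
import Data.Fin as Fin
open import Data.Product using (_×_; _,_; proj₁; proj₂; Σ; ∃)
open import Data.List.Relation.Unary.All using (All)
open import Data.List.Relation.Unary.Unique.Propositional using (Unique)
open import Relation.Binary.PropositionalEquality using (_≡_)

-- Partitions / skew shapes, given as sequences of a common length ℓ
-- (partitions padded with zeros).

IsPartition : ∀ {ℓ} → Vec ℕ ℓ → Set
IsPartition {ℓ} v = (i j : Fin ℓ) → i Fin.≤ j → lookup v j ≤ lookup v i

_⊆ₚ_ : ∀ {ℓ} → Vec ℕ ℓ → Vec ℕ ℓ → Set
_⊆ₚ_ {ℓ} β α = (i : Fin ℓ) → lookup β i ≤ lookup α i

IsSkewShape : ∀ {ℓ} → Vec ℕ ℓ → Vec ℕ ℓ → Set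
IsSkewShape α β = IsPartition α × IsPartition β × (β ⊆ₚ α)

nth : {A : Set} → List A → ℕ → Maybe A
nth []       _       = nothing
nth (x ∷ xs) zero    = just x
nth (x ∷ xs) (suc n) = nth xs n

nthℕ : List ℕ → ℕ → ℕ
nthℕ xs n with nth xs n
... | just x  = x
... | nothing = 0

-- part α i : the i-th part α_i (1-indexed), 0 if i = 0 or i > ℓ
part : ∀ {ℓ} → Vec ℕ ℓ → ℕ → ℕ
part α zero    = 0
part α (suc i) = nthℕ (toList α) i

inSkew : ∀ {ℓ} → Vec ℕ ℓ → Vec ℕ ℓ → ℕ → ℕ → Bool
inSkew α β zero    j = false
inSkew α β (suc i) j = (part β (suc i) <ᵇ j) ∧ (j ≤ᵇ part α (suc i))

half : ℕ → ℕ
half zero          = zero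
half (suc zero)    = zero
half (suc (suc n)) = suc (half n)

odd : ℕ → Bool
odd zero          = false
odd (suc zero)    = true
odd (suc (suc n)) = odd n

-- The shuffle diagram D = (α/β) ⊛ (γ/δ), rows and columns 1-indexed:
-- a square at (2i-1, 2j-1) for each (i,j) ∈ α/β and at (2i, 2j) for each
-- (i,j) ∈ γ/δ.

inShuffle : ∀ {ℓ} → (α β γ δ : Vec ℕ ℓ) → ℕ → ℕ → Bool
inShuffle α β γ δ R C =
  if odd R ∧ odd C then inSkew α β (half (suc R)) (half (suc C))
  else if not (odd R) ∧ not (odd C) then inSkew γ δ (half R) (half C)
  else false

countUpTo : (ℕ → Bool) → ℕ → ℕ
countUpTo f zero    = 0
countUpTo f (suc n) = (if f (suc n) then 1 else 0) + countUpTo f n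

colBound : ∀ {ℓ} → (α β γ δ : Vec ℕ ℓ) → ℕ
colBound α β γ δ = 2 * (sum (toList α) + sum (toList γ)) + 2

rowSize : ∀ {ℓ} → (α β γ δ : Vec ℕ ℓ) → ℕ → ℕ
rowSize α β γ δ R = countUpTo (inShuffle α β γ δ R) (colBound α β γ δ)

aCoef : ∀ {ℓ} → (α β γ δ : Vec ℕ ℓ) → ℕ → ℕ
aCoef α β γ δ i =
  countUpTo (λ C → inShuffle α β γ δ i C ∧ inShuffle α β γ δ (i + 2) C)
            (colBound α β γ δ)

-- Tableaux: a list of rows (top to bottom), each a list of entries
-- (left to right).  Positions (r , c) are 0-indexed here.

Tableau : Set
Tableau = List (List ℕ)

Pos : Set
Pos = ℕ × ℕ

entry : Tableau → ℕ → ℕ → Maybe ℕ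
entry T r c with nth T r
... | just row = nth row c
... | nothing  = nothing

shape : Tableau → List ℕ
shape T = map length T

record IsSSYT (T : Tableau) : Set where
  field
    shapePartition : ∀ r → nthℕ (shape T) (suc r) ≤ nthℕ (shape T) r
    positive       : ∀ r c x → entry T r c ≡ just x → 1 ≤ x
    rowWeak        : ∀ r c x y → entry T r c ≡ just x → entry T r (suc c) ≡ just y → x ≤ y
    colStrict      : ∀ r c x y → entry T r c ≡ just x → entry T (suc r) c ≡ just y → x < y

countEntries : ℕ → Tableau → ℕ
countEntries v []           = 0
countEntries v (row ∷ rows) = countRow row + countEntries v rows
  where
  countRow : List ℕ → ℕ
  countRow []       = 0
  countRow (x ∷ xs) = (if x ≡ᵇ v then 1 else 0) + countRow xs

ValidPair : Tableau → ℕ → Pos × Pos → Set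
ValidPair T i ((r₁ , c₁) , (r₂ , c₂)) =
  entry T r₁ c₁ ≡ just i × entry T r₂ c₂ ≡ just (i + 2) × r₁ ≤ r₂ × c₂ ≤ c₁

record Peelable {ℓ} (α β γ δ : Vec ℕ ℓ) (T : Tableau) : Set where
  field
    ssyt    : IsSSYT T
    content : ∀ r → 1 ≤ r → countEntries r T ≡ rowSize α β γ δ r
    pairs   : ∀ i → 1 ≤ i →
              Σ (List (Pos × Pos)) λ ps →
                aCoef α β γ δ i ≤ length ps ×
                All (ValidPair T i) ps ×
                Unique (map proj₁ ps) ×
                Unique (map proj₂ ps)

-- Bender–Knuth involution BK_i.
-- An i at (r,c) is "paired" if an i+1 lies directly below it; an i+1 at (r,c)
-- is "paired" if an i lies directly above it.  All other i's and (i+1)'s are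
-- free.  In every row, with b free i's and c free (i+1)'s, the free entries
-- (from left to right) are replaced by c entries i followed by b entries i+1.

isJust≡ : Maybe ℕ → ℕ → Bool
isJust≡ (just x) v = x ≡ᵇ v
isJust≡ nothing  v = false

pairedAt : Tableau → ℕ → ℕ → ℕ → Bool
pairedAt T i r c with entry T r c
... | nothing = false
... | just x  =
  if x ≡ᵇ i then isJust≡ (entry T (suc r) c) (suc i)
  else if x ≡ᵇ suc i then (case-prev r)
  else false
  where
  case-prev : ℕ → Bool
  case-prev zero    = false
  case-prev (suc r') = isJust≡ (entry T r' c) i

freeAt : Tableau → ℕ → ℕ → ℕ → Bool
freeAt T i r c with entry T r c
... | nothing = false
... | just x  = ((x ≡ᵇ i) ∨' (x ≡ᵇ suc i)) ∧ not (pairedAt T i r c)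
  where
  _∨'_ : Bool → Bool → Bool
  true  ∨' _ = true
  false ∨' b = b

countFreeSucc : Tableau → ℕ → ℕ → ℕ → List ℕ → ℕ
countFreeSucc T i r c []       = 0
countFreeSucc T i r c (x ∷ xs) =
  (if freeAt T i r c ∧ (x ≡ᵇ suc i) then 1 else 0) + countFreeSucc T i r (suc c) xs

-- rewrite row r (its suffix starting at column c); k = number of free
-- squares already seen in this row, m = number of free (i+1)'s in this row
bkRow : Tableau → ℕ → ℕ → ℕ → ℕ → ℕ → List ℕ → List ℕ
bkRow T i m r c k []       = []
bkRow T i m r c k (x ∷ xs) =
  if freeAt T i r c
  then (if k <ᵇ m then i else suc i) ∷ bkRow T i m r (suc c) (suc k) xs
  else x ∷ bkRow T i m r (suc c) k xs

bkRows : Tableau → ℕ → ℕ → List (List ℕ) → List (List ℕ)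
bkRows T i r []           = []
bkRows T i r (row ∷ rows) =
  bkRow T i (countFreeSucc T i r 0 row) r 0 0 row ∷ bkRows T i (suc r) rows

BK : ℕ → Tableau → Tableau
BK i T = bkRows T i 0 T

bkOdd : ℕ → Tableau → Tableau
bkOdd zero    T = T
bkOdd (suc k) T = bkOdd k (BK (2 * k + 1) T)

module Submission where

-- In a semistandard tableau an i lies Northeast of an i + 2 exactly when it lies
-- in a weakly later column.  Writing N v x for the number of v's in the columns
-- before x, Hall's theorem for this nested matching says that there are a disjoint
-- pairs iff a + N i x ≤ N (i + 2) x + N i ∞ for every x.
--
-- Let T' = BK i T.  Then N' (i + 1) x ≤ N i x, with equality if x is clean, that
-- is, if no row has free squares on both sides of x.  Applied to the letters i and
-- i + 2 separately, this turns the inequalities for T into those for the other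
-- parity in the final tableau, but one of the two letters is controlled only at
-- clean x, with respect to its own free squares.  An unclean x
-- cuts a row of free squares in two.  Over the columns of that row the other letter
-- occurs only in an adjacent row, where it fills an initial or a final segment.
-- Hence walking to a suitable end of the row of free squares never
-- increases the slack of the inequality, and both ends are clean.

open import Defs
open import Data.Bool using (Bool; true; false; if_then_else_; _∧_; not; T)
open import Data.Bool.Properties using (∧-zeroʳ; ¬-not)
open import Data.Empty using (⊥-elim)
open import Data.List using (List; []; _∷_; _++_; length; map)
open import Data.List.Properties using (length-map)
open import Data.List.Relation.Binary.Permutation.Propositional using (↭-sym; ↭⇒↭ₛ)
open import Data.List.Relation.Binary.Permutation.Propositional.Properties using (shift; All-resp-↭)
import Data.List.Relation.Binary.Permutation.Setoid.Properties as Permutationₛ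
open import Data.List.Relation.Unary.All as All using (All; []; _∷_)
open import Data.List.Relation.Unary.AllPairs using ([]; _∷_)
open import Data.List.Relation.Unary.Unique.Propositional using (Unique)
open import Data.Maybe using (Maybe; just)
open import Data.Maybe.Properties using (just-injective)
open import Data.Nat hiding (parity)
open import Data.Nat.ListAction using (sum)
open import Data.Nat.Properties
open import Data.Product using (_×_; _,_; proj₁; proj₂; Σ; ∃)
open import Data.Sum using (_⊎_; inj₁; inj₂)
open import Data.Vec using (Vec; []; _∷_; toList)
open import Function using (_∘_; id)
open import Relation.Binary.PropositionalEquality
open import Relation.Binary.Definitions using (Tri; tri<; tri≈; tri>)
open import Relation.Nullary using (¬_; Dec; yes; no; contradiction)
open import Relation.Nullary.Decidable using (_×-dec_)

open Permutationₛ (setoid Pos) using (Unique-resp-↭)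

-- Finite sums

∑ : ℕ → (ℕ → ℕ) → ℕ
∑ zero    f = 0
∑ (suc n) f = ∑ n f + f n

∑-cong : ∀ n {f g : ℕ → ℕ} → (∀ k → f k ≡ g k) → ∑ n f ≡ ∑ n g
∑-cong zero    f≗g = refl
∑-cong (suc n) f≗g = cong₂ _+_ (∑-cong n f≗g) (f≗g n)

∑-mono : ∀ n {f g : ℕ → ℕ} → (∀ k → k < n → f k ≤ g k) → ∑ n f ≤ ∑ n g
∑-mono zero    f≤g = z≤n
∑-mono (suc n) f≤g = +-mono-≤ (∑-mono n (λ k k<n → f≤g k (m<n⇒m<1+n k<n))) (f≤g n (n<1+n n))

∑-zero : ∀ n {f : ℕ → ℕ} → (∀ k → k < n → f k ≡ 0) → ∑ n f ≡ 0
∑-zero zero    f≗0 = refl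
∑-zero (suc n) f≗0 =
  cong₂ _+_ (∑-zero n (λ k k<n → f≗0 k (m<n⇒m<1+n k<n))) (f≗0 n (n<1+n n))

+-interchange : ∀ a b c d → (a + b) + (c + d) ≡ (a + c) + (b + d)
+-interchange a b c d = begin
  (a + b) + (c + d) ≡⟨ +-assoc a b (c + d) ⟩
  a + (b + (c + d)) ≡⟨ cong (a +_) (+-assoc b c d) ⟨
  a + ((b + c) + d) ≡⟨ cong (λ e → a + (e + d)) (+-comm b c) ⟩
  a + ((c + b) + d) ≡⟨ cong (a +_) (+-assoc c b d) ⟩
  a + (c + (b + d)) ≡⟨ +-assoc a c (b + d) ⟨
  (a + c) + (b + d) ∎
  where open ≡-Reasoning

∑-+ : ∀ n (f g : ℕ → ℕ) → ∑ n (λ k → f k + g k) ≡ ∑ n f + ∑ n g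
∑-+ zero    f g = refl
∑-+ (suc n) f g =
  trans (cong (_+ (f n + g n)) (∑-+ n f g)) (+-interchange (∑ n f) (∑ n g) (f n) (g n))

∑-swap : ∀ m n (f : ℕ → ℕ → ℕ) → ∑ m (λ i → ∑ n (f i)) ≡ ∑ n (λ j → ∑ m (λ i → f i j))
∑-swap zero    n f = sym (∑-zero n (λ _ _ → refl))
∑-swap (suc m) n f =
  trans (cong (_+ ∑ n (f m)) (∑-swap m n f)) (sym (∑-+ n (λ j → ∑ m (λ i → f i j)) (f m)))

∑-head : ∀ n (f : ℕ → ℕ) → ∑ (suc n) f ≡ f 0 + ∑ n (f ∘ suc)
∑-head zero    f = sym (+-identityʳ (f 0))
∑-head (suc n) f =
  trans (cong (_+ f (suc n)) (∑-head n f)) (+-assoc (f 0) (∑ n (f ∘ suc)) (f (suc n)))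

∑-extend : ∀ {m n} {f : ℕ → ℕ} → m ≤ n → (∀ k → m ≤ k → f k ≡ 0) → ∑ n f ≡ ∑ m f
∑-extend {zero}  {n}     z≤n f≗0 = ∑-zero n (λ k _ → f≗0 k z≤n)
∑-extend {suc m} {suc n} {f} (s≤s m≤n) f≗0 = begin
  ∑ (suc n) f         ≡⟨ ∑-head n f ⟩
  f 0 + ∑ n (f ∘ suc) ≡⟨ cong (f 0 +_) (∑-extend m≤n (λ k m≤k → f≗0 (suc k) (s≤s m≤k))) ⟩
  f 0 + ∑ m (f ∘ suc) ≡⟨ ∑-head m f ⟨
  ∑ (suc m) f         ∎
  where open ≡-Reasoning

∑-term : ∀ {n k} (f : ℕ → ℕ) → k < n → f k ≤ ∑ n f
∑-term {suc n} {k} f k<1+n with k ≟ n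
... | yes refl = m≤n+m (f n) (∑ n f)
... | no  k≢n  = ≤-trans (∑-term f (≤∧≢⇒< (s≤s⁻¹ k<1+n) k≢n)) (m≤m+n (∑ n f) (f n))

∑-monoˡ : ∀ {m n} (f : ℕ → ℕ) → m ≤ n → ∑ m f ≤ ∑ n f
∑-monoˡ {n = zero}  f z≤n = z≤n
∑-monoˡ {m} {suc n} f m≤1+n with m ≟ suc n
... | yes refl = ≤-refl
... | no  m≢   = ≤-trans (∑-monoˡ f (s≤s⁻¹ (≤∧≢⇒< m≤1+n m≢))) (m≤m+n (∑ n f) (f n))

∑-≤-support : ∀ x {m} {f : ℕ → ℕ} → (∀ k → m ≤ k → f k ≡ 0) → ∑ x f ≤ ∑ m f
∑-≤-support x {m} {f} f≗0 with ≤-total x m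
... | inj₁ x≤m = ∑-monoˡ f x≤m
... | inj₂ m≤x = ≤-reflexive (∑-extend m≤x f≗0)

∑-positive : ∀ n {f : ℕ → ℕ} → 0 < ∑ n f → ∃ λ k → k < n × 0 < f k
∑-positive (suc n) {f} 0<∑ with f n in fn
... | suc _ = n , n<1+n n , subst (0 <_) (sym fn) z<s
... | zero with ∑-positive n (subst (0 <_) (+-identityʳ (∑ n f)) 0<∑)
...   | k , k<n , 0<fk = k , m<n⇒m<1+n k<n , 0<fk

∑-≤1 : ∀ n {f : ℕ → ℕ} → (∀ k → f k ≤ 1) → (∀ j k → 0 < f j → 0 < f k → j ≡ k) → ∑ n f ≤ 1
∑-≤1 zero    f≤1 uniq = z≤n
∑-≤1 (suc n) {f} f≤1 uniq with f n in fn
... | zero  = subst (_≤ 1) (sym (+-identityʳ (∑ n f))) (∑-≤1 n f≤1 uniq)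
... | suc _ = subst (λ s → s + suc _ ≤ 1) (sym (∑-zero n vanish)) (subst (_≤ 1) fn (f≤1 n))
  where
  vanish : ∀ k → k < n → f k ≡ 0
  vanish k k<n with f k in fk
  ... | zero  = refl
  ... | suc _ = contradiction
    (uniq k n (subst (0 <_) (sym fk) z<s) (subst (0 <_) (sym fn) z<s)) (<⇒≢ k<n)

𝟙 : Bool → ℕ
𝟙 b = if b then 1 else 0

𝟙≤1 : ∀ b → 𝟙 b ≤ 1
𝟙≤1 true  = ≤-refl
𝟙≤1 false = z≤n

𝟙-positive : ∀ {b} → 0 < 𝟙 b → b ≡ true
𝟙-positive {true} _ = refl

𝟙-split : ∀ a b → 𝟙 b ≡ 𝟙 (a ∧ b) + 𝟙 (not a ∧ b)
𝟙-split true  b = sym (+-identityʳ (𝟙 b))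
𝟙-split false b = refl

≡true-cong : ∀ {a b} → (a ≡ true → b ≡ true) → (b ≡ true → a ≡ true) → a ≡ b
≡true-cong {true}          a⇒b b⇒a = sym (a⇒b refl)
≡true-cong {false} {true}  a⇒b b⇒a = b⇒a refl
≡true-cong {false} {false} a⇒b b⇒a = refl

-- Entries of tableaux

≡ᵇ-refl : ∀ n → (n ≡ᵇ n) ≡ true
≡ᵇ-refl zero    = refl
≡ᵇ-refl (suc n) = ≡ᵇ-refl n

≡ᵇ-true : ∀ m n → (m ≡ᵇ n) ≡ true → m ≡ n
≡ᵇ-true zero    zero    _  = refl
≡ᵇ-true (suc m) (suc n) eq = cong suc (≡ᵇ-true m n eq)

≡ᵇ-false : ∀ {m n} → m ≢ n → (m ≡ᵇ n) ≡ false
≡ᵇ-false {m} {n} m≢n = ¬-not (m≢n ∘ ≡ᵇ-true m n)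

isJust≡-sound : ∀ {m v} → isJust≡ m v ≡ true → m ≡ just v
isJust≡-sound {just x} {v} eq = cong just (≡ᵇ-true x v eq)

isJust≡-complete : ∀ {m v} → m ≡ just v → isJust≡ m v ≡ true
isJust≡-complete {v = v} refl = ≡ᵇ-refl v

isJust≡-cong : ∀ {m n v} → (m ≡ just v → n ≡ just v) → (n ≡ just v → m ≡ just v) →
               isJust≡ m v ≡ isJust≡ n v
isJust≡-cong m⇒n n⇒m =
  ≡true-cong (isJust≡-complete ∘ m⇒n ∘ isJust≡-sound) (isJust≡-complete ∘ n⇒m ∘ isJust≡-sound)

isJust≡-false : ∀ {m v} → m ≢ just v → isJust≡ m v ≡ false
isJust≡-false m≢ = ¬-not (m≢ ∘ isJust≡-sound)

≟just : ∀ (m : Maybe ℕ) v → Dec (m ≡ just v)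
≟just m v with isJust≡ m v in eq
... | true  = yes (isJust≡-sound eq)
... | false = no λ m≡ → contradiction (trans (sym eq) (isJust≡-complete m≡)) λ ()

nth-bound : ∀ (xs : List ℕ) {n x} → nth xs n ≡ just x → n < length xs
nth-bound (_ ∷ _) {zero}  _  = z<s
nth-bound (_ ∷ xs) {suc n} eq = s<s (nth-bound xs eq)

nth-exists : ∀ (xs : List ℕ) {n} → n < length xs → ∃ λ x → nth xs n ≡ just x
nth-exists (x ∷ xs) {zero}  _         = x , refl
nth-exists (x ∷ xs) {suc n} (s≤s n<l) = nth-exists xs n<l

rowLength : Tableau → ℕ → ℕ
rowLength U r = nthℕ (shape U) r

entry⇒< : ∀ U r {c x} → entry U r c ≡ just x → c < rowLength U r
entry⇒< (row ∷ U) zero    eq = nth-bound row eq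
entry⇒< (row ∷ U) (suc r) eq = entry⇒< U r eq

entry⇒row< : ∀ U r {c x} → entry U r c ≡ just x → r < length U
entry⇒row< (row ∷ U) zero    eq = z<s
entry⇒row< (row ∷ U) (suc r) eq = s<s (entry⇒row< U r eq)

<⇒entry : ∀ U r {c} → c < rowLength U r → ∃ λ x → entry U r c ≡ just x
<⇒entry (row ∷ U) zero    c<l = nth-exists row c<l
<⇒entry (row ∷ U) (suc r) c<l = <⇒entry U r c<l

module _ {U : Tableau} (S : IsSSYT U) where
  open IsSSYT S

  entry-left : ∀ {r c c′ y} → c ≤ c′ → entry U r c′ ≡ just y → ∃ λ x → entry U r c ≡ just x × x ≤ y
  entry-left {r} {c} {zero}   {y} z≤n eq = y , eq , ≤-refl
  entry-left {r} {c} {suc c′} {y} c≤1+c′ eq with c ≟ suc c′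
  ... | yes refl = y , eq , ≤-refl
  ... | no  c≢
    with <⇒entry U r (<-trans (n<1+n c′) (entry⇒< U r eq))
  ... | z , eqz with entry-left (s≤s⁻¹ (≤∧≢⇒< c≤1+c′ c≢)) eqz
  ... | x , eqx , x≤z = x , eqx , ≤-trans x≤z (rowWeak r c′ z y eqz eq)

  -- A partition shape has no hole above an occupied square, so `colStrict` always has a square to
  -- compare with.
  entry-up : ∀ {r c y} → entry U (suc r) c ≡ just y → ∃ λ x → entry U r c ≡ just x × x < y
  entry-up {r} {c} {y} eq with <⇒entry U r (<-≤-trans (entry⇒< U (suc r) eq) (shapePartition r))
  ... | x , eqx = x , eqx , colStrict r c x y eqx eq

  entry-above : ∀ {r r′ c y} → r < r′ → entry U r′ c ≡ just y → ∃ λ x → entry U r c ≡ just x × x < y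
  entry-above {r} {suc r′} r<1+r′ eq with entry-up eq
  ... | z , eqz , z<y with r ≟ r′
  ...   | yes refl = z , eqz , z<y
  ...   | no  r≢ with entry-above (≤∧≢⇒< (s≤s⁻¹ r<1+r′) r≢) eqz
  ...     | x , eqx , x<z = x , eqx , <-trans x<z z<y

  row-mono : ∀ {r c c′ x y} → c ≤ c′ → entry U r c ≡ just x → entry U r c′ ≡ just y → x ≤ y
  row-mono c≤c′ eqx eqy with entry-left c≤c′ eqy
  ... | x′ , eqx′ , x′≤y = subst (_≤ _) (just-injective (trans (sym eqx′) eqx)) x′≤y

  column-mono : ∀ {r r′ c x y} → r < r′ → entry U r c ≡ just x → entry U r′ c ≡ just y → x < y
  column-mono r<r′ eqx eqy with entry-above r<r′ eqy
  ... | x′ , eqx′ , x′<y = subst (_< _) (just-injective (trans (sym eqx′) eqx)) x′<y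

  column-unique : ∀ {r r′ c v} → entry U r c ≡ just v → entry U r′ c ≡ just v → r ≡ r′
  column-unique {r} {r′} eq eq′ with <-cmp r r′
  ... | tri< r<r′ _ _ = contradiction (column-mono r<r′ eq eq′) (n≮n _)
  ... | tri≈ _ r≡r′ _ = r≡r′
  ... | tri> _ _ r′<r = contradiction (column-mono r′<r eq′ eq) (n≮n _)

-- Free squares and the effect of a Bender–Knuth involution

-- Evidence form of `freeAt`. In `high` the row above enters through `r ≡ suc s`, so the condition
-- is vacuous in the top row.
data Free (U : Tableau) (i r c : ℕ) : Set where
  low  : entry U r c ≡ just i → entry U (suc r) c ≢ just (suc i) → Free U i r c
  high : entry U r c ≡ just (suc i) → (∀ {s} → r ≡ suc s → entry U s c ≢ just i) → Free U i r c

suc≢ᵇ : ∀ i → (suc i ≡ᵇ i) ≡ false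
suc≢ᵇ zero    = refl
suc≢ᵇ (suc i) = suc≢ᵇ i

pairedAt-low : ∀ U i r c → entry U r c ≡ just i →
               pairedAt U i r c ≡ isJust≡ (entry U (suc r) c) (suc i)
pairedAt-low U i r c e rewrite e | ≡ᵇ-refl i = refl

pairedAt-high : ∀ U i r c → entry U (suc r) c ≡ just (suc i) →
                pairedAt U i (suc r) c ≡ isJust≡ (entry U r c) i
pairedAt-high U i r c e rewrite e | suc≢ᵇ i | ≡ᵇ-refl i = refl

pairedAt-top : ∀ U i c → entry U 0 c ≡ just (suc i) → pairedAt U i 0 c ≡ false
pairedAt-top U i c e rewrite e | suc≢ᵇ i | ≡ᵇ-refl i = refl

freeAt-low : ∀ U i r c → entry U r c ≡ just i → freeAt U i r c ≡ not (pairedAt U i r c)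
freeAt-low U i r c e with entry U r c in eq
freeAt-low U i r c refl | just .i rewrite ≡ᵇ-refl i | eq | ≡ᵇ-refl i = refl

freeAt-high : ∀ U i r c → entry U r c ≡ just (suc i) → freeAt U i r c ≡ not (pairedAt U i r c)
freeAt-high U i r c e with entry U r c in eq
freeAt-high U i r c refl | just .(suc i) rewrite suc≢ᵇ i | ≡ᵇ-refl i | eq | suc≢ᵇ i | ≡ᵇ-refl i = refl

freeAt-entry : ∀ U i r c → freeAt U i r c ≡ true →
               entry U r c ≡ just i ⊎ entry U r c ≡ just (suc i)
freeAt-entry U i r c f with entry U r c
... | just x with x ≡ᵇ i in xi
...   | true  = inj₁ (cong just (≡ᵇ-true x i xi))
...   | false with x ≡ᵇ suc i in xsi
...     | true = inj₂ (cong just (≡ᵇ-true x (suc i) xsi))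

isJust≡-refute : ∀ {m v} → not (isJust≡ m v) ≡ true → m ≢ just v
isJust≡-refute n≡ m≡ with trans (sym n≡) (cong not (isJust≡-complete m≡))
... | ()

freeAt-sound : ∀ U i r c → freeAt U i r c ≡ true → Free U i r c
freeAt-sound U i r c f with freeAt-entry U i r c f
... | inj₁ e = low e (isJust≡-refute
  (trans (cong not (sym (pairedAt-low U i r c e))) (trans (sym (freeAt-low U i r c e)) f)))
freeAt-sound U i zero    c f | inj₂ e = high e λ ()
freeAt-sound U i (suc r) c f | inj₂ e = high e λ { refl → isJust≡-refute
  (trans (cong not (sym (pairedAt-high U i r c e))) (trans (sym (freeAt-high U i (suc r) c e)) f)) }

freeAt-complete : ∀ U i r c → Free U i r c → freeAt U i r c ≡ true
freeAt-complete U i r c (low e b) =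
  trans (freeAt-low U i r c e)
        (cong not (trans (pairedAt-low U i r c e) (isJust≡-false b)))
freeAt-complete U i zero c (high e a) =
  trans (freeAt-high U i 0 c e) (cong not (pairedAt-top U i c e))
freeAt-complete U i (suc r) c (high e a) =
  trans (freeAt-high U i (suc r) c e)
        (cong not (trans (pairedAt-high U i r c e) (isJust≡-false (a refl))))

Free? : ∀ U i r c → Dec (Free U i r c)
Free? U i r c with freeAt U i r c in eq
... | true  = yes (freeAt-sound U i r c eq)
... | false = no λ f → contradiction (trans (sym eq) (freeAt-complete U i r c f)) λ ()

freeAt-false : ∀ U i r c → ¬ Free U i r c → freeAt U i r c ≡ false
freeAt-false U i r c ¬f = ¬-not (¬f ∘ freeAt-sound U i r c)

Free-entry : ∀ {U i r c} → Free U i r c → ∃ λ x → entry U r c ≡ just x × i ≤ x × x ≤ suc i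
Free-entry {i = i} (low e _)  = i , e , ≤-refl , n≤1+n i
Free-entry {i = i} (high e _) = suc i , e , n≤1+n i , ≤-refl

-- Closed form of the entries after a Bender-Knuth involution

rank : Tableau → ℕ → ℕ → ℕ → ℕ
rank U i r c = ∑ c (λ k → 𝟙 (freeAt U i r k))

-- Together with `rank` this replaces the running arguments `k` and `m` of `bkRow`: a free square
-- receives `i` exactly when its rank is below the quota of its row.
quota : Tableau → ℕ → ℕ → ℕ
quota U i r =
  ∑ (rowLength U r) (λ k → 𝟙 (freeAt U i r k ∧ isJust≡ (entry U r k) (suc i)))

countFreeSucc-∑ : ∀ U i r c xs → countFreeSucc U i r c xs ≡
  ∑ (length xs) (λ k → 𝟙 (freeAt U i r (c + k) ∧ isJust≡ (nth xs k) (suc i)))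
countFreeSucc-∑ U i r c []       = refl
countFreeSucc-∑ U i r c (x ∷ xs) = begin
  𝟙 (freeAt U i r c ∧ (x ≡ᵇ suc i)) + countFreeSucc U i r (suc c) xs
    ≡⟨ cong₂ _+_ (cong (λ d → 𝟙 (freeAt U i r d ∧ (x ≡ᵇ suc i))) (sym (+-identityʳ c)))
         (trans (countFreeSucc-∑ U i r (suc c) xs)
                (∑-cong (length xs) λ k →
                  cong (λ d → 𝟙 (freeAt U i r d ∧ isJust≡ (nth xs k) (suc i)))
                       (sym (+-suc c k)))) ⟩
  f 0 + ∑ (length xs) (f ∘ suc)
    ≡⟨ ∑-head (length xs) f ⟨
  ∑ (suc (length xs)) f ∎
  where
  open ≡-Reasoning
  f : ℕ → ℕ
  f k = 𝟙 (freeAt U i r (c + k) ∧ isJust≡ (nth (x ∷ xs) k) (suc i))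

nth-bkRow-fixed : ∀ U i m r c k xs j → freeAt U i r (c + j) ≡ false →
                  nth (bkRow U i m r c k xs) j ≡ nth xs j
nth-bkRow-fixed U i m r c k []       j       eq = refl
nth-bkRow-fixed U i m r c k (x ∷ xs) zero    eq
  rewrite trans (cong (freeAt U i r) (sym (+-identityʳ c))) eq = refl
nth-bkRow-fixed U i m r c k (x ∷ xs) (suc j) eq with freeAt U i r c
... | true  = nth-bkRow-fixed U i m r (suc c) (suc k) xs j (trans (cong (freeAt U i r) (sym (+-suc c j))) eq)
... | false = nth-bkRow-fixed U i m r (suc c) k xs j (trans (cong (freeAt U i r) (sym (+-suc c j))) eq)

-- The start column `c` and the count `k` are arbitrary because both change as the recursion moves
-- along the row.
nth-bkRow-free : ∀ U i m r c k xs j → j < length xs → freeAt U i r (c + j) ≡ true →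
  nth (bkRow U i m r c k xs) j ≡
  just (if k + ∑ j (λ d → 𝟙 (freeAt U i r (c + d))) <ᵇ m then i else suc i)
nth-bkRow-free U i m r c k (x ∷ xs) zero    _ eq
  rewrite trans (cong (freeAt U i r) (sym (+-identityʳ c))) eq | +-identityʳ k = refl
nth-bkRow-free U i m r c k (x ∷ xs) (suc j) (s≤s j<l) eq =
  trans (step (freeAt U i r c) refl) (cong (λ s → just (if s <ᵇ m then i else suc i)) count)
  where
  eq′ : freeAt U i r (suc c + j) ≡ true
  eq′ = trans (cong (freeAt U i r) (sym (+-suc c j))) eq
  before : ℕ
  before = ∑ j (λ d → 𝟙 (freeAt U i r (suc c + d)))
  count : (k + 𝟙 (freeAt U i r c)) + before ≡ k + ∑ (suc j) (λ d → 𝟙 (freeAt U i r (c + d)))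
  count = trans (+-assoc k _ before) (cong (k +_) (sym (trans
    (∑-head j (λ d → 𝟙 (freeAt U i r (c + d))))
    (cong₂ _+_ (cong (𝟙 ∘ freeAt U i r) (+-identityʳ c))
               (∑-cong j λ d → cong (𝟙 ∘ freeAt U i r) (+-suc c d))))))
  step : ∀ b → freeAt U i r c ≡ b → nth (bkRow U i m r c k (x ∷ xs)) (suc j) ≡
         just (if (k + 𝟙 (freeAt U i r c)) + before <ᵇ m then i else suc i)
  step true e rewrite e | +-comm k 1 = nth-bkRow-free U i m r (suc c) (suc k) xs j j<l eq′
  step false e rewrite e | +-identityʳ k = nth-bkRow-free U i m r (suc c) k xs j j<l eq′

bkRow-of : Tableau → ℕ → ℕ → List ℕ → List ℕ
bkRow-of U i r row = bkRow U i (countFreeSucc U i r 0 row) r 0 0 row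

length-bkRow : ∀ U i m r c k xs → length (bkRow U i m r c k xs) ≡ length xs
length-bkRow U i m r c k []       = refl
length-bkRow U i m r c k (x ∷ xs) with freeAt U i r c
... | true  = cong suc (length-bkRow U i m r (suc c) (suc k) xs)
... | false = cong suc (length-bkRow U i m r (suc c) k xs)

shape-bkRows : ∀ U i r rows → shape (bkRows U i r rows) ≡ shape rows
shape-bkRows U i r []           = refl
shape-bkRows U i r (row ∷ rows) =
  cong₂ _∷_ (length-bkRow U i _ r 0 0 row) (shape-bkRows U i (suc r) rows)

shape-BK : ∀ i U → shape (BK i U) ≡ shape U
shape-BK i U = shape-bkRows U i 0 U

entry-bkRows-fixed : ∀ U i s rows r c → freeAt U i (s + r) c ≡ false →
                     entry (bkRows U i s rows) r c ≡ entry rows r c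
entry-bkRows-fixed U i s []           r       c eq = refl
entry-bkRows-fixed U i s (row ∷ rows) zero    c eq =
  nth-bkRow-fixed U i _ s 0 0 row c (trans (cong (λ r → freeAt U i r c) (sym (+-identityʳ s))) eq)
entry-bkRows-fixed U i s (row ∷ rows) (suc r) c eq =
  entry-bkRows-fixed U i (suc s) rows r c (trans (cong (λ r → freeAt U i r c) (sym (+-suc s r))) eq)

-- The recursion sees only the rows from `s` on, while freeness is read off the whole of `U`; the
-- hypothesis on `entry rows` ties the two together.
entry-bkRows-free : ∀ U i s rows r c → (∀ r c → entry rows r c ≡ entry U (s + r) c) →
  c < rowLength rows r → freeAt U i (s + r) c ≡ true →
  entry (bkRows U i s rows) r c ≡
  just (if rank U i (s + r) c <ᵇ ∑ (rowLength rows r)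
             (λ k → 𝟙 (freeAt U i (s + r) k ∧ isJust≡ (entry U (s + r) k) (suc i)))
        then i else suc i)
entry-bkRows-free U i s (row ∷ rows) zero    c agree c<l eq = begin
  nth (bkRow-of U i s row) c
    ≡⟨ nth-bkRow-free U i _ s 0 0 row c c<l (trans (cong (λ r → freeAt U i r c) (sym (+-identityʳ s))) eq) ⟩
  just (if rank U i s c <ᵇ countFreeSucc U i s 0 row then i else suc i)
    ≡⟨ cong₂ (λ s′ m → just (if rank U i s′ c <ᵇ m then i else suc i))
         (sym (+-identityʳ s))
         (trans (countFreeSucc-∑ U i s 0 row) (∑-cong (length row) λ k →
           cong₂ (λ s′ e → 𝟙 (freeAt U i s′ k ∧ isJust≡ e (suc i)))
                 (sym (+-identityʳ s)) (agree 0 k))) ⟩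
  _ ∎
  where open ≡-Reasoning
entry-bkRows-free U i s (row ∷ rows) (suc r) c agree c<l eq
  rewrite +-suc s r =
  entry-bkRows-free U i (suc s) rows r c
    (λ r′ c′ → trans (agree (suc r′) c′) (cong (λ q → entry U q c′) (+-suc s r′))) c<l eq

BK-fixed : ∀ {U i r c} → ¬ Free U i r c → entry (BK i U) r c ≡ entry U r c
BK-fixed {U} {i} {r} {c} ¬f = entry-bkRows-fixed U i 0 U r c (freeAt-false U i r c ¬f)

BK-free-entry : ∀ {U i r c} → Free U i r c →
  entry (BK i U) r c ≡ just (if rank U i r c <ᵇ quota U i r then i else suc i)
BK-free-entry {U} {i} {r} {c} f =
  entry-bkRows-free U i 0 U r c (λ _ _ → refl)
    (entry⇒< U r (proj₁ (proj₂ (Free-entry f)))) (freeAt-complete U i r c f)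

just-unique : ∀ {m : Maybe ℕ} {x y} → m ≡ just x → m ≡ just y → x ≡ y
just-unique e e′ = just-injective (trans (sym e) e′)

i≤x≤1+i : ∀ {i x} → i ≤ x → x ≤ suc i → x ≡ i ⊎ x ≡ suc i
i≤x≤1+i {i} {x} i≤x x≤1+i with x ≟ i
... | yes x≡i = inj₁ x≡i
... | no  x≢i = inj₂ (≤-antisym x≤1+i (≤∧≢⇒< i≤x (x≢i ∘ sym)))

¬Free-low : ∀ {U i r c} → ¬ Free U i r c → entry U r c ≡ just i → entry U (suc r) c ≡ just (suc i)
¬Free-low {U} {i} {r} {c} ¬f e with ≟just (entry U (suc r) c) (suc i)
... | yes b = b
... | no  b = contradiction (low e b) ¬f

¬Free-high : ∀ {U i r c} → ¬ Free U i r c → entry U r c ≡ just (suc i) →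
             ∃ λ s → r ≡ suc s × entry U s c ≡ just i
¬Free-high {U} {i} {zero}  {c} ¬f e = contradiction (high e λ ()) ¬f
¬Free-high {U} {i} {suc s} {c} ¬f e with ≟just (entry U s c) i
... | yes a = s , refl , a
... | no  a = contradiction (high e λ { refl → a }) ¬f

¬Free-other : ∀ {U i r c x} → entry U r c ≡ just x → x ≢ i → x ≢ suc i → ¬ Free U i r c
¬Free-other e x≢i x≢1+i (low e′ _)  = x≢i (just-unique e e′)
¬Free-other e x≢i x≢1+i (high e′ _) = x≢1+i (just-unique e e′)

¬Free-above : ∀ {U i r c} → entry U r c ≡ just i → entry U (suc r) c ≡ just (suc i) → ¬ Free U i r c
¬Free-above e e↓ (low _ b)   = b e↓
¬Free-above e e↓ (high e′ _) = contradiction (just-unique e e′) (<⇒≢ (n<1+n _))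

¬Free-below : ∀ {U i r c} → entry U r c ≡ just i → entry U (suc r) c ≡ just (suc i) →
              ¬ Free U i (suc r) c
¬Free-below e e↓ (low e′ _) = contradiction (just-unique e′ e↓) (<⇒≢ (n<1+n _))
¬Free-below e e↓ (high _ a) = a refl e

BK-choice : ∀ b i → i ≤ (if b then i else suc i) × (if b then i else suc i) ≤ suc i
BK-choice true  i = ≤-refl , n≤1+n i
BK-choice false i = n≤1+n i , ≤-refl

BK-free-bounds : ∀ {U i r c x} → Free U i r c → entry (BK i U) r c ≡ just x → i ≤ x × x ≤ suc i
BK-free-bounds {U} {i} {r} {c} f e
  with just-unique e (BK-free-entry f) | BK-choice (rank U i r c <ᵇ quota U i r) i
... | refl | bounds = bounds

<ᵇ-choice-mono : ∀ {a b} m i → a ≤ b →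
                 (if a <ᵇ m then i else suc i) ≤ (if b <ᵇ m then i else suc i)
<ᵇ-choice-mono {a} {b} m i a≤b with a <ᵇ m in a<m | b <ᵇ m in b<m
... | true  | true  = ≤-refl
... | true  | false = n≤1+n i
... | false | false = ≤-refl
... | false | true  = contradiction
  (trans (sym a<m) (T⇒≡true (<⇒<ᵇ (≤-<-trans a≤b (<ᵇ⇒< b m (≡true⇒T b<m)))))) λ ()
  where
  T⇒≡true : ∀ {b} → T b → b ≡ true
  T⇒≡true {true} _ = refl
  ≡true⇒T : ∀ {b} → b ≡ true → T b
  ≡true⇒T refl = _

-- Semistandardness of the result and the structure of free squares

module _ {U : Tableau} (S : IsSSYT U) (i : ℕ) where
  open IsSSYT S

  -- By strictness two stacked free squares would hold `i` over `suc i`, and would then be paired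
  -- with each other.
  Free-column-unique : ∀ {r c} → Free U i r c → ¬ Free U i (suc r) c
  Free-column-unique f f↓ with Free-entry f | Free-entry f↓
  ... | x , e , i≤x , _ | y , e↓ , _ , y≤1+i
    with ≤-antisym i≤x (s≤s⁻¹ (≤-trans x<y y≤1+i)) | ≤-antisym y≤1+i (≤-<-trans i≤x x<y)
    where
    x<y : x < y
    x<y = colStrict _ _ x y e e↓
  ...   | refl | refl = ¬Free-above e e↓ f

  private
    -- Of two free neighbours the right one has the larger or equal rank, so it never gets the
    -- smaller letter. A fixed neighbour could only interfere as a paired `suc i` on the left or a
    -- paired `i` on the right; semistandardness then forces the free square to be paired as well.
    BK-rowWeak : ∀ r c x y → entry (BK i U) r c ≡ just x → entry (BK i U) r (suc c) ≡ just y → x ≤ y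
    BK-rowWeak r c x y e e′ with Free? U i r c | Free? U i r (suc c)
    ... | no ¬f | no ¬f′ = rowWeak r c x y (trans (sym (BK-fixed ¬f)) e) (trans (sym (BK-fixed ¬f′)) e′)
    ... | yes f | yes f′
      rewrite just-unique e (BK-free-entry f) | just-unique e′ (BK-free-entry f′) =
      <ᵇ-choice-mono (quota U i r) i (m≤m+n (rank U i r c) _)
    ... | no ¬f | yes f′ with x ≤? i
    ...   | yes x≤i = ≤-trans x≤i (proj₁ (BK-free-bounds f′ e′))
    ...   | no  x≰i with Free-entry f′
    ...     | y₀ , e₀ , _ , y₀≤1+i = ⊥-elim (paired (¬Free-high ¬f eᵢ))
      where
      eU : entry U r c ≡ just x
      eU = trans (sym (BK-fixed ¬f)) e
      x≤y₀ : x ≤ y₀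
      x≤y₀ = rowWeak r c x y₀ eU e₀
      eᵢ : entry U r c ≡ just (suc i)
      eᵢ = trans eU (cong just (≤-antisym (≤-trans x≤y₀ y₀≤1+i) (≰⇒> x≰i)))
      e₀ᵢ : entry U r (suc c) ≡ just (suc i)
      e₀ᵢ = trans e₀ (cong just (≤-antisym y₀≤1+i (≤-trans (≰⇒> x≰i) x≤y₀)))
      paired : ¬ ∃ λ s → r ≡ suc s × entry U s c ≡ just i
      paired (s , refl , a) with entry-up S e₀ᵢ
      ... | z , a′ , z<1+i = ¬Free-below
        (trans a′ (cong just (≤-antisym (s≤s⁻¹ z<1+i) (row-mono S (n≤1+n c) a a′)))) e₀ᵢ f′
    BK-rowWeak r c x y e e′ | yes f | no ¬f′ with suc i ≤? y
    ...   | yes i<y = ≤-trans (proj₂ (BK-free-bounds f e)) i<y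
    ...   | no  i≮y with Free-entry f
    ...     | x₀ , e₀ , i≤x₀ , _ = ⊥-elim (paired (¬Free-low ¬f′ e′ᵢ))
      where
      e′U : entry U r (suc c) ≡ just y
      e′U = trans (sym (BK-fixed ¬f′)) e′
      x₀≤y : x₀ ≤ y
      x₀≤y = rowWeak r c x₀ y e₀ e′U
      y≤i : y ≤ i
      y≤i = s≤s⁻¹ (≰⇒> i≮y)
      e′ᵢ : entry U r (suc c) ≡ just i
      e′ᵢ = trans e′U (cong just (≤-antisym y≤i (≤-trans i≤x₀ x₀≤y)))
      e₀ᵢ : entry U r c ≡ just i
      e₀ᵢ = trans e₀ (cong just (≤-antisym (≤-trans x₀≤y y≤i) i≤x₀))
      paired : ¬ entry U (suc r) (suc c) ≡ just (suc i)
      paired b with entry-left S (n≤1+n c) b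
      ... | z , b′ , z≤1+i = ¬Free-above e₀ᵢ
        (trans b′ (cong just (≤-antisym z≤1+i (colStrict r c i z e₀ᵢ b′)))) f

    -- At most one of the two squares is free. A fixed entry below a free square exceeds `suc i`,
    -- and one above is less than `i`, since otherwise the free square would be paired; so either
    -- new letter fits.
    BK-colStrict : ∀ r c x y → entry (BK i U) r c ≡ just x → entry (BK i U) (suc r) c ≡ just y → x < y
    BK-colStrict r c x y e e↓ with Free? U i r c | Free? U i (suc r) c
    ... | no ¬f | no ¬f↓ = colStrict r c x y (trans (sym (BK-fixed ¬f)) e) (trans (sym (BK-fixed ¬f↓)) e↓)
    ... | yes f | yes f↓ = contradiction f↓ (Free-column-unique f)
    ... | yes f | no ¬f↓ with Free-entry f
    ...   | x₀ , e₀ , i≤x₀ , _ = ≤-<-trans (proj₂ (BK-free-bounds f e)) (≤∧≢⇒< (≤-<-trans i≤x₀ x₀<y) 1+i≢y)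
      where
      e↓U : entry U (suc r) c ≡ just y
      e↓U = trans (sym (BK-fixed ¬f↓)) e↓
      x₀<y : x₀ < y
      x₀<y = colStrict r c x₀ y e₀ e↓U
      1+i≢y : suc i ≢ y
      1+i≢y refl = ¬Free-above (trans e₀ (cong just (≤-antisym (s≤s⁻¹ x₀<y) i≤x₀))) e↓U f
    BK-colStrict r c x y e e↓ | no ¬f | yes f↓ with Free-entry f↓
    ...   | y₀ , e₀ , _ , y₀≤1+i = <-≤-trans (≤∧≢⇒< (s≤s⁻¹ (≤-trans x<y₀ y₀≤1+i)) x≢i) (proj₁ (BK-free-bounds f↓ e↓))
      where
      eU : entry U r c ≡ just x
      eU = trans (sym (BK-fixed ¬f)) e
      x<y₀ : x < y₀
      x<y₀ = colStrict r c x y₀ eU e₀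
      x≢i : x ≢ i
      x≢i refl = ¬Free-below eU (trans e₀ (cong just (≤-antisym y₀≤1+i x<y₀))) f↓

  BK-SSYT : 1 ≤ i → IsSSYT (BK i U)
  BK-SSYT 1≤i = record
    { shapePartition = λ r → subst (λ s → nthℕ s (suc r) ≤ nthℕ s r) (sym (shape-BK i U)) (shapePartition r)
    ; positive       = λ r c x e → pos r c x e (Free? U i r c)
    ; rowWeak        = BK-rowWeak
    ; colStrict      = BK-colStrict
    }
    where
    pos : ∀ r c x → entry (BK i U) r c ≡ just x → Dec (Free U i r c) → 1 ≤ x
    pos r c x e (yes f) = ≤-trans 1≤i (proj₁ (BK-free-bounds f e))
    pos r c x e (no ¬f) = positive r c x (trans (sym (BK-fixed ¬f)) e)

  -- The vertical neighbours of a free square are not free and hence keep their entries. A partner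
  -- for the new letter would already have been a partner for the old one.
  Free-BK : ∀ {r c} → Free U i r c → Free (BK i U) i r c
  Free-BK {r} {c} f with Free-entry f | BK-free-entry f
  ... | x , e , i≤x , x≤1+i | e′ with rank U i r c <ᵇ quota U i r
  ...   | true  = low e′ λ b′ → let b = trans (sym (BK-fixed (Free-column-unique f))) b′ in
    ¬Free-above (trans e (cong just (≤-antisym (s≤s⁻¹ (colStrict r c x (suc i) e b)) i≤x))) b f
  ...   | false = high e′ λ { {s} refl a′ →
    let a = trans (sym (BK-fixed λ f↑ → Free-column-unique f↑ f)) a′ in
    ¬Free-below a (trans e (cong just (≤-antisym x≤1+i (colStrict s c i x a e)))) f }

  -- Pairing spreads along a row: a paired `i` forces the squares holding `i` to its left to be
  -- paired, and a paired `suc i` those holding `suc i` to its right. Hence no paired square lies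
  -- between two free ones.
  Free-convex : ∀ {r c d c′} → c ≤ d → d ≤ c′ → Free U i r c → Free U i r c′ → Free U i r d
  Free-convex {r} {c} {d} {c′} c≤d d≤c′ f f′ with Free? U i r d | Free-entry f | Free-entry f′
  ... | yes g | _ | _ = g
  ... | no ¬g | x , e , i≤x , _ | x′ , e′ , _ , x′≤1+i with entry-left S d≤c′ e′
  ...   | y , eʸ , y≤x′ with i≤x≤1+i (≤-trans i≤x (row-mono S c≤d e eʸ)) (≤-trans y≤x′ x′≤1+i)
  ...     | inj₁ refl with entry-left S c≤d (¬Free-low ¬g eʸ)
  ...       | z , b , z≤1+i = contradiction f (¬Free-above eᵢ (trans b (cong just (≤-antisym z≤1+i (colStrict r c i z eᵢ b)))))
    where
    eᵢ : entry U r c ≡ just i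
    eᵢ = trans e (cong just (≤-antisym (row-mono S c≤d e eʸ) i≤x))
  Free-convex {r} {c} {d} {c′} c≤d d≤c′ f f′ | no ¬g | x , e , i≤x , _ | x′ , e′ , _ , x′≤1+i | y , eʸ , y≤x′
          | inj₂ refl with ¬Free-high ¬g eʸ
  ...       | s , refl , a with entry-up S e′
  ...         | z , a′ , z<x′ = contradiction f′ (¬Free-below
    (trans a′ (cong just (≤-antisym (s≤s⁻¹ (≤-trans z<x′ x′≤1+i)) (row-mono S d≤c′ a a′))))
    (trans e′ (cong just (≤-antisym x′≤1+i y≤x′))))

infix 4 _≈[_]_

-- Only the squares of the letter `v` are compared, since an involution acting on other letters may
-- change everything else.
_≈[_]_ : Tableau → ℕ → Tableau → Set
U ≈[ v ] V = ∀ r c → (entry U r c ≡ just v → entry V r c ≡ just v) ×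
                     (entry V r c ≡ just v → entry U r c ≡ just v)

BK-other : ∀ {U i v} → v ≢ i → v ≢ suc i → BK i U ≈[ v ] U
BK-other {U} {i} {v} v≢i v≢1+i r c with Free? U i r c
... | no ¬f = trans (sym (BK-fixed ¬f)) , trans (BK-fixed ¬f)
... | yes f = absurd , λ e → contradiction f (¬Free-other e v≢i v≢1+i)
  where
  absurd : ∀ {A : Set} → entry (BK i U) r c ≡ just v → A
  absurd e with i≤x≤1+i (proj₁ (BK-free-bounds f e)) (proj₂ (BK-free-bounds f e))
  ... | inj₁ v≡i   = contradiction v≡i v≢i
  ... | inj₂ v≡1+i = contradiction v≡1+i v≢1+i

Free-≈ : ∀ {U V i r c} → U ≈[ i ] V → U ≈[ suc i ] V → Free U i r c → Free V i r c
Free-≈ {r = r} {c} ≈i ≈1+i (low e b)  = low (proj₁ (≈i r c) e) (b ∘ proj₂ (≈1+i (suc r) c))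
Free-≈ {r = r} {c} ≈i ≈1+i (high e a) =
  high (proj₁ (≈1+i r c) e) λ {s} r≡ → a r≡ ∘ proj₂ (≈i s c)

-- Column counts

columnCount : Tableau → ℕ → ℕ → ℕ
columnCount U v c = ∑ (length U) (λ r → 𝟙 (isJust≡ (entry U r c) v))

countBefore : Tableau → ℕ → ℕ → ℕ
countBefore U v x = ∑ x (columnCount U v)

shape⇒length : ∀ {U V : Tableau} → shape U ≡ shape V → length U ≡ length V
shape⇒length {U} {V} eq = trans (sym (length-map length U)) (trans (cong length eq) (length-map length V))

columnCount-≈ : ∀ {U V v} c → shape U ≡ shape V → U ≈[ v ] V → columnCount U v c ≡ columnCount V v c
columnCount-≈ {U} {V} {v} c sh U≈V rewrite shape⇒length {U} {V} sh =
  ∑-cong (length V) λ r → cong 𝟙 (isJust≡-cong (proj₁ (U≈V r c)) (proj₂ (U≈V r c)))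

countBefore-≈ : ∀ {U V v} x → shape U ≡ shape V → U ≈[ v ] V → countBefore U v x ≡ countBefore V v x
countBefore-≈ x sh U≈V = ∑-cong x λ c → columnCount-≈ c sh U≈V

entry⇒columnCount : ∀ U {v r c} → entry U r c ≡ just v → 1 ≤ columnCount U v c
entry⇒columnCount U {v} {r} {c} e = ≤-trans
  (≤-reflexive (cong 𝟙 (sym (isJust≡-complete e))))
  (∑-term (λ r → 𝟙 (isJust≡ (entry U r c) v)) (entry⇒row< U r e))

columnCount⇒entry : ∀ U {v c} → 1 ≤ columnCount U v c → ∃ λ r → entry U r c ≡ just v
columnCount⇒entry U 1≤ with ∑-positive (length U) 1≤
... | r , _ , 0< = r , isJust≡-sound (𝟙-positive 0<)

columnCount-≤1 : ∀ {U v c} → IsSSYT U → columnCount U v c ≤ 1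
columnCount-≤1 {U} {v} {c} S = ∑-≤1 (length U) (λ r → 𝟙≤1 _) λ r s 0<r 0<s →
  column-unique S (isJust≡-sound (𝟙-positive 0<r)) (isJust≡-sound (𝟙-positive 0<s))

countEntries-∷ : ∀ v row rows → countEntries v (row ∷ rows) ≡
  ∑ (length row) (λ c → 𝟙 (isJust≡ (nth row c) v)) + countEntries v rows
countEntries-∷ v []       rows = refl
countEntries-∷ v (x ∷ xs) rows = begin
  countEntries v ((x ∷ xs) ∷ rows)
    ≡⟨ +-assoc e _ (countEntries v rows) ⟩
  e + countEntries v (xs ∷ rows)
    ≡⟨ cong (e +_) (countEntries-∷ v xs rows) ⟩
  e + (∑ (length xs) (λ c → 𝟙 (isJust≡ (nth xs c) v)) + countEntries v rows)
    ≡⟨ +-assoc e _ (countEntries v rows) ⟨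
  (e + ∑ (length xs) (λ c → 𝟙 (isJust≡ (nth xs c) v))) + countEntries v rows
    ≡⟨ cong (_+ countEntries v rows) (∑-head (length xs) _) ⟨
  ∑ (suc (length xs)) (λ c → 𝟙 (isJust≡ (nth (x ∷ xs) c) v)) + countEntries v rows ∎
  where
  open ≡-Reasoning
  e : ℕ
  e = if x ≡ᵇ v then 1 else 0

-- Padding all rows to a common length `M` makes the double sum rectangular, so that rows and
-- columns can be interchanged.
countEntries-rows : ∀ v U M → (∀ r → rowLength U r ≤ M) →
  countEntries v U ≡ ∑ (length U) (λ r → ∑ M (λ c → 𝟙 (isJust≡ (entry U r c) v)))
countEntries-rows v []           M bound = refl
countEntries-rows v (row ∷ rows) M bound = begin
  countEntries v (row ∷ rows)
    ≡⟨ countEntries-∷ v row rows ⟩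
  ∑ (length row) (λ c → 𝟙 (isJust≡ (nth row c) v)) + countEntries v rows
    ≡⟨ cong₂ _+_ (sym (∑-extend (bound 0) λ c l≤c → cong 𝟙 (isJust≡-false λ e → ≤⇒≯ l≤c (nth-bound row e))))
                 (countEntries-rows v rows M (bound ∘ suc)) ⟩
  ∑ M (λ c → 𝟙 (isJust≡ (nth row c) v)) +
    ∑ (length rows) (λ r → ∑ M (λ c → 𝟙 (isJust≡ (entry rows r c) v)))
    ≡⟨ ∑-head (length rows) (λ r → ∑ M (λ c → 𝟙 (isJust≡ (entry (row ∷ rows) r c) v))) ⟨
  ∑ (suc (length rows)) (λ r → ∑ M (λ c → 𝟙 (isJust≡ (entry (row ∷ rows) r c) v))) ∎
  where open ≡-Reasoning

-- The number of squares rather than the true width: a crude bound on every row length that depends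
-- on the shape alone.
width : Tableau → ℕ
width U = sum (shape U)

rowLength≤width : ∀ U r → rowLength U r ≤ width U
rowLength≤width []           r       = z≤n
rowLength≤width (row ∷ rows) zero    = m≤m+n (length row) (width rows)
rowLength≤width (row ∷ rows) (suc r) = ≤-trans (rowLength≤width rows r) (m≤n+m (width rows) (length row))

countEntries-countBefore : ∀ v U → countEntries v U ≡ countBefore U v (width U)
countEntries-countBefore v U = trans (countEntries-rows v U (width U) (rowLength≤width U))
  (∑-swap (length U) (width U) λ r c → 𝟙 (isJust≡ (entry U r c) v))

-- Here `x` is the vertical line between columns `x - 1` and `x`, matching the strict bound in
-- `countBefore`.
Clean : Tableau → ℕ → ℕ → Set
Clean U i x = ∀ {r c d} → c < x → x ≤ d → Free U i r c → ¬ Free U i r d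

Clean-beyond : ∀ U i {x} → width U ≤ x → Clean U i x
Clean-beyond U i w≤x {r} _ x≤d _ f = ≤⇒≯ (≤-trans w≤x x≤d)
  (<-≤-trans (entry⇒< U r (proj₁ (proj₂ (Free-entry f)))) (rowLength≤width U r))

-- The free square of rank `a` becomes `suc i` exactly when `m ≤ a`, which is when the truncated
-- difference grows.
∸-step : ∀ a m i → (a ∸ m) + 𝟙 (isJust≡ (just (if a <ᵇ m then i else suc i)) (suc i)) ≡ (a + 1) ∸ m
∸-step a       zero    i rewrite ≡ᵇ-refl i = refl
∸-step zero    (suc m) i rewrite ≡ᵇ-false (m≢1+n+m i {0}) = sym (0∸n≡0 m)
∸-step (suc a) (suc m) i = ∸-step a m i

module _ (U : Tableau) (i : ℕ) where

  private
    -- Freeness is always taken in `U`, entries in `W`, so that the same squares are counted before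
    -- and after the involution.
    freeCount : Tableau → ℕ → ℕ → ℕ → ℕ
    freeCount W v r x = ∑ x (λ c → 𝟙 (freeAt U i r c ∧ isJust≡ (entry W r c) v))

    pairedCount : Tableau → ℕ → ℕ → ℕ
    pairedCount W v c = ∑ (length U) (λ r → 𝟙 (not (freeAt U i r c) ∧ isJust≡ (entry W r c) v))

    countBefore-split : ∀ W v x → length W ≡ length U → countBefore W v x ≡
      ∑ (length U) (λ r → freeCount W v r x) + ∑ x (pairedCount W v)
    countBefore-split W v x eq rewrite eq = begin
      ∑ x (λ c → ∑ R (λ r → 𝟙 (e r c)))
        ≡⟨ (∑-cong x λ c → trans (∑-cong R λ r → 𝟙-split (freeAt U i r c) (e r c))
                                 (∑-+ R _ _)) ⟩
      ∑ x (λ c → ∑ R (λ r → 𝟙 (freeAt U i r c ∧ e r c)) + pairedCount W v c)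
        ≡⟨ ∑-+ x _ _ ⟩
      ∑ x (λ c → ∑ R (λ r → 𝟙 (freeAt U i r c ∧ e r c))) + ∑ x (pairedCount W v)
        ≡⟨ cong (_+ ∑ x (pairedCount W v)) (∑-swap x R _) ⟩
      ∑ R (λ r → freeCount W v r x) + ∑ x (pairedCount W v) ∎
      where
      open ≡-Reasoning
      R : ℕ
      R = length U
      e : ℕ → ℕ → Bool
      e r c = isJust≡ (entry W r c) v

    paired-sound : ∀ W v r c → (not (freeAt U i r c) ∧ isJust≡ (entry W r c) v) ≡ true →
                   ¬ Free U i r c × entry W r c ≡ just v
    paired-sound W v r c eq with freeAt U i r c in f | isJust≡ (entry W r c) v in e
    ... | false | true = (λ g → contradiction (trans (sym f) (freeAt-complete U i r c g)) λ ()) , isJust≡-sound e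

    paired-complete : ∀ W v r c → ¬ Free U i r c → entry W r c ≡ just v →
                      (not (freeAt U i r c) ∧ isJust≡ (entry W r c) v) ≡ true
    paired-complete W v r c ¬f e rewrite freeAt-false U i r c ¬f = isJust≡-complete e

    -- The paired i+1's lie directly below the paired i's.
    pairedCount-BK : ∀ c → pairedCount (BK i U) (suc i) c ≡ pairedCount U i c
    pairedCount-BK c = begin
      ∑ R q               ≡⟨ +-identityʳ (∑ R q) ⟨
      -- The sum is reindexed by one row: row `R` is empty, and the top row has no paired `suc i`.
      ∑ R q + 0           ≡⟨ cong (∑ R q +_) last ⟨
      ∑ (suc R) q         ≡⟨ ∑-head R q ⟩
      q 0 + ∑ R (q ∘ suc) ≡⟨ cong₂ _+_ first (∑-cong R (cong 𝟙 ∘ shifted)) ⟩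
      ∑ R p               ∎
      where
      open ≡-Reasoning
      R : ℕ
      R = length U
      qᵇ pᵇ : ℕ → Bool
      qᵇ r = not (freeAt U i r c) ∧ isJust≡ (entry (BK i U) r c) (suc i)
      pᵇ r = not (freeAt U i r c) ∧ isJust≡ (entry U r c) i
      q p : ℕ → ℕ
      q = 𝟙 ∘ qᵇ
      p = 𝟙 ∘ pᵇ
      qᵇ-sound : ∀ r → qᵇ r ≡ true → ¬ Free U i r c × entry U r c ≡ just (suc i)
      qᵇ-sound r eq with paired-sound (BK i U) (suc i) r c eq
      ... | ¬f , e = ¬f , trans (sym (BK-fixed ¬f)) e
      last : q R ≡ 0
      last = cong 𝟙 (¬-not λ eq → n≮n R (entry⇒row< U R (proj₂ (qᵇ-sound R eq))))
      first : q 0 ≡ 0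
      first = cong 𝟙 (¬-not λ eq → absurd (qᵇ-sound 0 eq))
        where
        absurd : ¬ (¬ Free U i 0 c × entry U 0 c ≡ just (suc i))
        absurd (¬f , e) with ¬Free-high ¬f e
        ... | _ , () , _
      shifted : ∀ r → qᵇ (suc r) ≡ pᵇ r
      shifted r = ≡true-cong to from
        where
        to : qᵇ (suc r) ≡ true → pᵇ r ≡ true
        to eq with qᵇ-sound (suc r) eq
        ... | ¬f , e with ¬Free-high ¬f e
        ...   | .r , refl , a = paired-complete U i r c (¬Free-above a e) a
        from : pᵇ r ≡ true → qᵇ (suc r) ≡ true
        from eq with paired-sound U i r c eq
        ... | ¬f , e = paired-complete (BK i U) (suc i) (suc r) c ¬f↓ (trans (BK-fixed ¬f↓) e↓)
          where
          e↓ : entry U (suc r) c ≡ just (suc i)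
          e↓ = ¬Free-low ¬f e
          ¬f↓ : ¬ Free U i (suc r) c
          ¬f↓ = ¬Free-below e e↓

    rank-split : ∀ r x → rank U i r x ≡ freeCount U i r x + freeCount U (suc i) r x
    rank-split r x = trans (∑-cong x cell) (∑-+ x _ _)
      where
      cell : ∀ c → 𝟙 (freeAt U i r c) ≡
        𝟙 (freeAt U i r c ∧ isJust≡ (entry U r c) i) + 𝟙 (freeAt U i r c ∧ isJust≡ (entry U r c) (suc i))
      cell c with freeAt U i r c in f
      ... | false = refl
      ... | true with freeAt-entry U i r c f
      ...   | inj₁ e rewrite e | ≡ᵇ-refl i | ≡ᵇ-false (m≢1+n+m i {0}) = refl
      ...   | inj₂ e rewrite e | ≡ᵇ-refl i | suc≢ᵇ i = refl

    -- The first `quota` free squares of the row receive `i`; only the free squares after them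
    -- contribute.
    freeCount-BK : ∀ r x → freeCount (BK i U) (suc i) r x ≡ rank U i r x ∸ quota U i r
    freeCount-BK r zero    = sym (0∸n≡0 (quota U i r))
    freeCount-BK r (suc x) with freeAt U i r x in f
    ... | false = trans (+-identityʳ _) (trans (freeCount-BK r x) (cong (_∸ quota U i r) (sym (+-identityʳ _))))
    ... | true  = trans
      (cong₂ _+_ (freeCount-BK r x)
                 (cong (λ e → 𝟙 (isJust≡ e (suc i))) (BK-free-entry {U} (freeAt-sound U i r x f))))
      (∸-step (rank U i r x) (quota U i r) i)

    highs≤quota : ∀ r x → freeCount U (suc i) r x ≤ quota U i r
    highs≤quota r x = ∑-≤-support x λ k l≤k → cong 𝟙 (¬-not (outside k l≤k))
      where
      outside : ∀ k → rowLength U r ≤ k → ¬ (freeAt U i r k ∧ isJust≡ (entry U r k) (suc i)) ≡ true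
      outside k l≤k eq with freeAt U i r k | isJust≡ (entry U r k) (suc i) in e
      ... | true | true = ≤⇒≯ l≤k (entry⇒< U r (isJust≡-sound e))

    -- Of the `α + β` free squares before `x` the quota `m` is removed, and `m` is at least the
    -- number `β` of old `suc i` among them.
    freeCount-BK-≤ : ∀ r x → freeCount (BK i U) (suc i) r x ≤ freeCount U i r x
    freeCount-BK-≤ r x = begin
      freeCount (BK i U) (suc i) r x ≡⟨ freeCount-BK r x ⟩
      rank U i r x ∸ m               ≡⟨ cong (_∸ m) (rank-split r x) ⟩
      (α + β) ∸ m                    ≤⟨ ∸-monoʳ-≤ (α + β) (highs≤quota r x) ⟩
      (α + β) ∸ β                    ≡⟨ m+n∸n≡m α β ⟩
      α                              ∎
      where
      open ≤-Reasoning
      m α β : ℕ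
      m = quota U i r
      α = freeCount U i r x
      β = freeCount U (suc i) r x

    -- Either no free square of the row precedes `x`, and both sides vanish, or all of them do; then
    -- `β` is the whole quota and the bound of `freeCount-BK-≤` is attained.
    freeCount-BK-clean : ∀ r x → Clean U i x → freeCount (BK i U) (suc i) r x ≡ freeCount U i r x
    freeCount-BK-clean r x clean with rank U i r x in rk
    ... | zero = trans (trans (freeCount-BK r x) (trans (cong (_∸ quota U i r) rk) (0∸n≡0 (quota U i r))))
                       (sym (m+n≡0⇒m≡0 _ (trans (sym (rank-split r x)) rk)))
    ... | suc _ with ∑-positive x (subst (0 <_) (sym rk) z<s)
    ...   | c , c<x , 0<f = begin
      freeCount (BK i U) (suc i) r x ≡⟨ freeCount-BK r x ⟩
      rank U i r x ∸ m               ≡⟨ cong (_∸ m) (rank-split r x) ⟩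
      (α + β) ∸ m                    ≡⟨ cong ((α + β) ∸_) (≤-antisym m≤β (highs≤quota r x)) ⟩
      (α + β) ∸ β                    ≡⟨ m+n∸n≡m α β ⟩
      α                              ∎
      where
      open ≡-Reasoning
      m α β : ℕ
      m = quota U i r
      α = freeCount U i r x
      β = freeCount U (suc i) r x
      outside : ∀ k → x ≤ k → 𝟙 (freeAt U i r k ∧ isJust≡ (entry U r k) (suc i)) ≡ 0
      outside k x≤k rewrite freeAt-false U i r k (clean c<x x≤k (freeAt-sound U i r c (𝟙-positive 0<f))) = refl
      m≤β : m ≤ β
      m≤β = ∑-≤-support (rowLength U r) outside

    length-BK : length (BK i U) ≡ length U
    length-BK = shape⇒length {BK i U} {U} (shape-BK i U)

  countBefore-BK-≤ : ∀ x → countBefore (BK i U) (suc i) x ≤ countBefore U i x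
  countBefore-BK-≤ x
    rewrite countBefore-split (BK i U) (suc i) x length-BK | countBefore-split U i x refl =
    +-mono-≤ (∑-mono (length U) λ r _ → freeCount-BK-≤ r x) (≤-reflexive (∑-cong x pairedCount-BK))

  countBefore-BK-clean : ∀ {x} → Clean U i x → countBefore (BK i U) (suc i) x ≡ countBefore U i x
  countBefore-BK-clean {x} clean
    rewrite countBefore-split (BK i U) (suc i) x length-BK | countBefore-split U i x refl =
    cong₂ _+_ (∑-cong (length U) λ r → freeCount-BK-clean r x clean) (∑-cong x pairedCount-BK)

  -- The set of squares holding `i` or `suc i` does not change, so only the split between the two
  -- letters does.
  countBefore-BK-+ : ∀ x → countBefore (BK i U) i x + countBefore (BK i U) (suc i) x ≡
                           countBefore U i x + countBefore U (suc i) x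
  countBefore-BK-+ x rewrite length-BK = trans (sym (∑-+ x _ _))
    (trans (∑-cong x λ c → trans (sym (∑-+ (length U) _ _))
                                 (trans (∑-cong (length U) λ r → cell r c) (∑-+ (length U) _ _)))
           (∑-+ x _ _))
    where
    lows : Maybe ℕ → ℕ
    lows e = 𝟙 (isJust≡ e i) + 𝟙 (isJust≡ e (suc i))
    lows-one : ∀ {x} → i ≤ x → x ≤ suc i → lows (just x) ≡ 1
    lows-one i≤x x≤1+i with i≤x≤1+i i≤x x≤1+i
    ... | inj₁ refl rewrite ≡ᵇ-refl i | ≡ᵇ-false (m≢1+n+m i {0}) = refl
    ... | inj₂ refl rewrite ≡ᵇ-refl i | suc≢ᵇ i = refl
    cell : ∀ r c → lows (entry (BK i U) r c) ≡ lows (entry U r c)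
    cell r c with Free? U i r c
    ... | no ¬f = cong lows (BK-fixed ¬f)
    ... | yes f with Free-entry f | BK-choice (rank U i r c <ᵇ quota U i r) i
    ...   | x , e , i≤x , x≤1+i | i≤y , y≤1+i =
      trans (trans (cong lows (BK-free-entry f)) (lows-one i≤y y≤1+i))
            (sym (trans (cong lows e) (lows-one i≤x x≤1+i)))

-- Clean columns minimise the matching deficiency

module Walk (g h : ℕ → ℕ) where

  infix 4 _⊑_

  -- p ⊑ x states f p ≤ f x for f = ∑ g − ∑ h, without subtraction.
  _⊑_ : ℕ → ℕ → Set
  p ⊑ x = ∑ p g + ∑ x h ≤ ∑ x g + ∑ p h

  ⊑-trans : ∀ {p q x} → p ⊑ q → q ⊑ x → p ⊑ x
  ⊑-trans {p} {q} {x} p⊑q q⊑x = +-cancelʳ-≤ (∑ q g + ∑ q h) _ _ (begin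
    (∑ p g + ∑ x h) + (∑ q g + ∑ q h)   ≡⟨ cong (_+ (∑ q g + ∑ q h)) (+-comm (∑ p g) _) ⟩
    (∑ x h + ∑ p g) + (∑ q g + ∑ q h)   ≡⟨ +-interchange (∑ x h) (∑ p g) (∑ q g) (∑ q h) ⟩
    (∑ x h + ∑ q g) + (∑ p g + ∑ q h)   ≤⟨ +-mono-≤ (≤-trans (≤-reflexive (+-comm (∑ x h) _)) q⊑x) p⊑q ⟩
    (∑ x g + ∑ q h) + (∑ q g + ∑ p h)   ≡⟨ cong ((∑ x g + ∑ q h) +_) (+-comm (∑ q g) _) ⟩
    (∑ x g + ∑ q h) + (∑ p h + ∑ q g)   ≡⟨ +-interchange (∑ x g) (∑ q h) (∑ p h) (∑ q g) ⟩
    (∑ x g + ∑ p h) + (∑ q h + ∑ q g)   ≡⟨ cong ((∑ x g + ∑ p h) +_) (+-comm (∑ q h) _) ⟩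
    (∑ x g + ∑ p h) + (∑ q g + ∑ q h)   ∎)
    where open ≤-Reasoning

  ⊑-right : ∀ x → g x ≤ h x → suc x ⊑ x
  ⊑-right x g≤h = begin
    (∑ x g + g x) + ∑ x h ≡⟨ +-assoc (∑ x g) (g x) (∑ x h) ⟩
    ∑ x g + (g x + ∑ x h) ≤⟨ +-monoʳ-≤ (∑ x g) (+-monoˡ-≤ (∑ x h) g≤h) ⟩
    ∑ x g + (h x + ∑ x h) ≡⟨ cong (∑ x g +_) (+-comm (h x) (∑ x h)) ⟩
    ∑ x g + (∑ x h + h x) ∎
    where open ≤-Reasoning

  ⊑-left : ∀ x → h x ≤ g x → x ⊑ suc x
  ⊑-left x h≤g = begin
    ∑ x g + (∑ x h + h x) ≡⟨ cong (∑ x g +_) (+-comm (∑ x h) (h x)) ⟩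
    ∑ x g + (h x + ∑ x h) ≤⟨ +-monoʳ-≤ (∑ x g) (+-monoˡ-≤ (∑ x h) h≤g) ⟩
    ∑ x g + (g x + ∑ x h) ≡⟨ +-assoc (∑ x g) (g x) (∑ x h) ⟨
    (∑ x g + g x) + ∑ x h ∎
    where open ≤-Reasoning

  -- The predicate `P` chooses the direction. It persists to the right along joined columns and
  -- makes steps to the right harmless; its negation persists to the left and does the same for
  -- steps to the left.
  module _ {Stop Joined P : ℕ → Set}
    (stop?  : ∀ x → Stop x ⊎ ∃ λ c → x ≡ suc c × Joined c)
    {M : ℕ} (Stop-M : ∀ {x} → M ≤ x → Stop x)
    (P?     : ∀ c → Dec (P c))
    (P-next : ∀ {c} → Joined c → P c → P (suc c))
    (P⇒≤    : ∀ {c} → P c → g c ≤ h c)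
    (¬P⇒≥   : ∀ {c} → ¬ P c → h c ≤ g c)
    where

    private
      -- The fuel `n` bounds the distance to `M`, where stopping is guaranteed.
      goRight : ∀ n c → M ≤ n + suc c → P c → ∃ λ p → Stop p × p ⊑ suc c
      goRight zero    c M≤ _  = suc c , Stop-M M≤ , ≤-refl
      goRight (suc n) c M≤ Pc with stop? (suc c)
      ... | inj₁ stop = suc c , stop , ≤-refl
      ... | inj₂ (.c , refl , joined)
        with goRight n (suc c) (≤-trans M≤ (≤-reflexive (sym (+-suc n (suc c))))) (P-next joined Pc)
      ...   | p , stop , p⊑ = p , stop , ⊑-trans {p} {suc (suc c)} {suc c} p⊑ (⊑-right (suc c) (P⇒≤ (P-next joined Pc)))

      goLeft : ∀ c → ¬ P c → ∃ λ p → Stop p × p ⊑ suc c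
      goLeft c ¬Pc with stop? c
      ... | inj₁ stop = c , stop , ⊑-left c (¬P⇒≥ ¬Pc)
      goLeft (suc c) ¬Pc | inj₂ (.c , refl , joined) with goLeft c (¬Pc ∘ P-next joined)
      ... | p , stop , p⊑ = p , stop , ⊑-trans {p} {suc c} {suc (suc c)} p⊑ (⊑-left (suc c) (¬P⇒≥ ¬Pc))

    nearest : ∀ x → ∃ λ p → Stop p × p ⊑ x
    nearest x with stop? x
    ... | inj₁ stop = x , stop , ≤-refl
    ... | inj₂ (c , refl , joined) with P? c
    ...   | yes Pc = goRight M c (m≤m+n M (suc c)) Pc
    ...   | no ¬Pc = goLeft c ¬Pc

-- Walking to clean columns in a tableau

module _ {U : Tableau} (S : IsSSYT U) where
  open IsSSYT S

  Joined : ℕ → ℕ → Set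
  Joined i c = ∃ λ r → Free U i r c × Free U i r (suc c)

  -- By convexity an unclean line already separates two adjacent free squares, so a search through
  -- the rows decides.
  clean? : ∀ i x → Clean U i x ⊎ ∃ λ c → x ≡ suc c × Joined i c
  clean? i zero    = inj₁ λ ()
  clean? i (suc c)
    with anyUpTo? (λ r → Free? U i r c ×-dec Free? U i r (suc c)) (length U)
  ... | yes (r , _ , f , f′) = inj₂ (c , refl , r , f , f′)
  ... | no  none = inj₁ λ {r} {b} {d} b≤c c<d f f′ → none
    (r , entry⇒row< U r (proj₁ (proj₂ (Free-entry f)))
       , Free-convex S i (s≤s⁻¹ b≤c) (<⇒≤ c<d) f f′
       , Free-convex S i (≤-trans (s≤s⁻¹ b≤c) (n≤1+n c)) c<d f f′)

  -- Strictness leaves only `suc v` to exclude, and that letter above a `suc (suc v)` would pair the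
  -- free square.
  above-free : ∀ {v r c y} → Free U (suc v) (suc r) c → entry U r c ≡ just y → v ≤ y → y ≡ v
  above-free {v} {r} {c} {y} (low e _)  a v≤y = ≤-antisym (s≤s⁻¹ (colStrict r c y (suc v) a e)) v≤y
  above-free {v} {r} {c} {y} (high e ¬a) a v≤y = ≤-antisym
    (s≤s⁻¹ (≤∧≢⇒< (s≤s⁻¹ (colStrict r c y (suc (suc v)) a e)) λ { refl → ¬a refl a })) v≤y

  below-free : ∀ {i r c y} → Free U i r c → entry U (suc r) c ≡ just y → y ≤ suc (suc i) → y ≡ suc (suc i)
  below-free {i} {r} {c} {y} (low e ¬b) b y≤ = ≤-antisym y≤
    (≤∧≢⇒< (colStrict r c i y e b) λ { refl → ¬b b })
  below-free {i} {r} {c} {y} (high e _) b y≤ = ≤-antisym y≤ (colStrict r c (suc i) y e b)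

  -- Over a row of free squares for `suc v`, a `v` can only stand directly above, and there it fills
  -- a final segment: moving right, the entry above stays at least `v`, and `above-free` pins it
  -- down. So walk right if the column contains a `v`, and left otherwise.
  nearest-clean-above : ∀ v x → ∃ λ p → Clean U (suc v) p ×
    countBefore U (suc (suc v)) p + countBefore U v x ≤ countBefore U (suc (suc v)) x + countBefore U v p
  nearest-clean-above v = Walk.nearest _ _ (clean? (suc v)) (Clean-beyond U (suc v))
    (λ c → 1 ≤? columnCount U v c) next
    (λ 1≤ → ≤-trans (columnCount-≤1 S) 1≤)
    (λ ¬1≤ → ≤-trans (s≤s⁻¹ (≰⇒> ¬1≤)) z≤n)
    where
    next : ∀ {c} → Joined (suc v) c → 1 ≤ columnCount U v c → 1 ≤ columnCount U v (suc c)
    next {c} (r , f , f′) 1≤ with columnCount⇒entry U 1≤ | Free-entry f | Free-entry f′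
    ... | s , e | x , eˣ , v<x , _ | x′ , eˣ′ , _ = go r s f f′ e eˣ eˣ′ (s<r (<-cmp s r))
      where
      s<r : Tri (s < r) (s ≡ r) (r < s) → s < r
      s<r (tri< lt _ _)   = lt
      s<r (tri≈ _ refl _) = contradiction (just-unique e eˣ) (<⇒≢ v<x)
      s<r (tri> _ _ r<s)  = contradiction (column-mono S r<s eˣ e) (<⇒≯ v<x)
      go : ∀ r s {x x′} → Free U (suc v) r c → Free U (suc v) r (suc c) → entry U s c ≡ just v →
           entry U r c ≡ just x → entry U r (suc c) ≡ just x′ → s < r → 1 ≤ columnCount U v (suc c)
      go (suc r) s f f′ e eˣ eˣ′ s≤r with entry-up S eˣ | entry-up S eˣ′
      ... | y , a , _ | y′ , a′ , _ = entry⇒columnCount U (trans a′ (cong just (above-free f′ a′ v≤y′)))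
        where
        v≤y : v ≤ y
        v≤y with s ≟ r
        ... | yes refl = ≤-reflexive (just-unique e a)
        ... | no  s≢r  = <⇒≤ (column-mono S (≤∧≢⇒< (s≤s⁻¹ s≤r) s≢r) e a)
        v≤y′ : v ≤ y′
        v≤y′ = ≤-trans v≤y (row-mono S (n≤1+n c) a a′)

  -- Mirror image of the previous walk: below a row of free squares for `i` the letter `suc (suc i)`
  -- fills an initial segment. So walk right if the column lacks this letter, and left otherwise.
  nearest-clean-below : ∀ i x → ∃ λ p → Clean U i p ×
    countBefore U (suc (suc i)) p + countBefore U i x ≤ countBefore U (suc (suc i)) x + countBefore U i p
  nearest-clean-below i = Walk.nearest _ _ (clean? i) (Clean-beyond U i)
    (λ c → columnCount U (suc (suc i)) c ≟ 0) next
    (λ ≡0 → ≤-trans (≤-reflexive ≡0) z≤n)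
    (λ ≢0 → ≤-trans (columnCount-≤1 S) (n≢0⇒n>0 ≢0))
    where
    -- The letter lies strictly below the free square, so the square directly beneath that one is
    -- occupied, by an entry no larger.
    below : ∀ {r c x′} s → entry U s (suc c) ≡ just (suc (suc i)) → entry U r (suc c) ≡ just x′ →
            x′ ≤ suc i → Tri (r < s) (r ≡ s) (s < r) → ∃ λ y → entry U (suc r) (suc c) ≡ just y × y ≤ suc (suc i)
    below {r} s e eˣ′ x′≤1+i (tri< r<s _ _) with suc r ≟ s
    ... | yes refl = suc (suc i) , e , ≤-refl
    ... | no  ≢s with entry-above S (≤∧≢⇒< r<s ≢s) e
    ...   | y , b , y< = y , b , <⇒≤ y<
    below s e eˣ′ x′≤1+i (tri≈ _ refl _) = contradiction (just-unique eˣ′ e) (<⇒≢ (s≤s x′≤1+i))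
    below s e eˣ′ x′≤1+i (tri> _ _ s<r)  = contradiction (column-mono S s<r e eˣ′) (<⇒≯ (s≤s x′≤1+i))
    next : ∀ {c} → Joined i c → columnCount U (suc (suc i)) c ≡ 0 → columnCount U (suc (suc i)) (suc c) ≡ 0
    next {c} (r , f , f′) ≡0 with columnCount U (suc (suc i)) (suc c) in eq
    ... | zero = refl
    ... | suc _ with columnCount⇒entry U (subst (1 ≤_) (sym eq) (s≤s z≤n)) | Free-entry f′
    ...   | s , e | x′ , eˣ′ , _ , x′≤1+i with below s e eˣ′ x′≤1+i (<-cmp r s)
    ...     | y , b , y≤ with entry-left S (n≤1+n c) b
    ...       | z , b′ , z≤y = contradiction
      (entry⇒columnCount U (trans b′ (cong just (below-free f b′ (≤-trans z≤y y≤)))))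
      (<⇒≱ (subst (_< 1) (sym ≡0) z<s))

-- Pairs and Hall's condition

-- The line `width U` lies beyond all columns, so the last summand is the total number of `u` in the
-- tableau.
Hall : ℕ → Tableau → ℕ → ℕ → Set
Hall a U u w = ∀ x → a + countBefore U u x ≤ countBefore U w x + countBefore U u (width U)

∑-erase : ∀ {n k d} {f g : ℕ → ℕ} → (∀ j → g j ≤ f j) → k < n → d + g k ≤ f k → d + ∑ n g ≤ ∑ n f
∑-erase {suc n} {k} {d} {f} {g} g≤f k<1+n d+g≤f with k ≟ n
... | yes refl = begin
  d + (∑ n g + g n) ≡⟨ cong (d +_) (+-comm (∑ n g) (g n)) ⟩
  d + (g n + ∑ n g) ≡⟨ +-assoc d (g n) (∑ n g) ⟨
  (d + g n) + ∑ n g ≤⟨ +-mono-≤ d+g≤f (∑-mono n λ j _ → g≤f j) ⟩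
  f n + ∑ n f       ≡⟨ +-comm (f n) (∑ n f) ⟩
  ∑ n f + f n       ∎
  where open ≤-Reasoning
... | no k≢n = begin
  d + (∑ n g + g n) ≡⟨ +-assoc d (∑ n g) (g n) ⟨
  (d + ∑ n g) + g n ≤⟨ +-mono-≤ (∑-erase g≤f (≤∧≢⇒< (s≤s⁻¹ k<1+n) k≢n) d+g≤f) (g≤f n) ⟩
  ∑ n f + f n       ∎
  where open ≤-Reasoning

total : (ℕ → ℕ → ℕ) → List Pos → ℕ
total w []             = 0
total w ((r , c) ∷ qs) = w r c + total w qs

erase : Pos → (ℕ → ℕ → ℕ) → ℕ → ℕ → ℕ
erase (r₀ , c₀) w r c = if (r ≡ᵇ r₀) ∧ (c ≡ᵇ c₀) then 0 else w r c

erase-≤ : ∀ q w r c → erase q w r c ≤ w r c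
erase-≤ (r₀ , c₀) w r c with (r ≡ᵇ r₀) ∧ (c ≡ᵇ c₀)
... | true  = z≤n
... | false = ≤-refl

erase-self : ∀ r c w → erase (r , c) w r c ≡ 0
erase-self r c w rewrite ≡ᵇ-refl r | ≡ᵇ-refl c = refl

erase-≢ : ∀ {q r c} w → q ≢ (r , c) → erase q w r c ≡ w r c
erase-≢ {r₀ , c₀} {r} {c} w q≢ with r ≡ᵇ r₀ in er | c ≡ᵇ c₀ in ec
... | false | _     = refl
... | true  | false = refl
... | true  | true  = contradiction (cong₂ _,_ (sym (≡ᵇ-true r r₀ er)) (sym (≡ᵇ-true c c₀ ec))) q≢

total-erase : ∀ {q qs} w → All (q ≢_) qs → total (erase q w) qs ≡ total w qs
total-erase w []         = refl
total-erase w (q≢ ∷ q≢s) = cong₂ _+_ (erase-≢ w q≢) (total-erase w q≢s)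

-- The head is paid for by erasing its weight. This does not affect the tail, which avoids that
-- square, and lowers the double sum by at least the weight erased.
total-unique : ∀ {R M} w {qs} → Unique qs → All (λ q → proj₁ q < R × proj₂ q < M) qs →
               total w qs ≤ ∑ M (λ c → ∑ R (λ r → w r c))
total-unique w []           []                   = z≤n
total-unique {R} {M} w {(r , c) ∷ qs} (q≢s ∷ uniq) ((r<R , c<M) ∷ bound) = begin
  w r c + total w qs
    ≡⟨ cong (w r c +_) (total-erase w q≢s) ⟨
  w r c + total w′ qs
    ≤⟨ +-monoʳ-≤ (w r c) (total-unique w′ uniq bound) ⟩
  w r c + ∑ M (λ c → ∑ R (λ r → w′ r c))
    ≤⟨ ∑-erase (λ c′ → ∑-mono R λ r′ _ → erase-≤ (r , c) w r′ c′) c<M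
         (∑-erase (λ r′ → erase-≤ (r , c) w r′ c) r<R
           (≤-reflexive (trans (cong (w r c +_) (erase-self r c w)) (+-identityʳ (w r c))))) ⟩
  ∑ M (λ c → ∑ R (λ r → w r c)) ∎
  where
  open ≤-Reasoning
  w′ : ℕ → ℕ → ℕ
  w′ = erase (r , c) w

<ᵇ-true : ∀ {m n} → m < n → (m <ᵇ n) ≡ true
<ᵇ-true {zero}  {suc n} _         = refl
<ᵇ-true {suc m} {suc n} (s≤s m<n) = <ᵇ-true m<n

<ᵇ-false : ∀ {m n} → n ≤ m → (m <ᵇ n) ≡ false
<ᵇ-false {m} {n} n≤m = ¬-not λ eq → ≤⇒≯ n≤m (<ᵇ⇒< m n (subst T (sym eq) _))

-- The necessary half of Hall's theorem. Since no square is repeated, the pairs can be charged to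
-- distinct squares: an `i` from `x` on or an `i + 2` before `x`.
pairs⇒Hall : ∀ {U i a ps} → a ≤ length ps → All (ValidPair U i) ps →
             Unique (map proj₁ ps) → Unique (map proj₂ ps) → Hall a U i (i + 2)
pairs⇒Hall {U} {i} {a} {ps} a≤ valid uniq₁ uniq₂ x = begin
  a + countBefore U i x
    ≤⟨ +-mono-≤ (≤-trans a≤ (cover ps valid)) before ⟩
  (total firsts (map proj₁ ps) + total seconds (map proj₂ ps)) + ∑ M (λ c → ∑ R (λ r → earlier r c))
    ≤⟨ +-monoˡ-≤ _ (+-mono-≤ (total-unique firsts uniq₁ (bound₁ ps valid)) (total-unique seconds uniq₂ (bound₂ ps valid))) ⟩
  (∑ M (λ c → ∑ R (λ r → firsts r c)) + ∑ M (λ c → ∑ R (λ r → seconds r c))) + ∑ M (λ c → ∑ R (λ r → earlier r c))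
    ≡⟨ rearrange (∑ M (λ c → ∑ R (λ r → firsts r c))) _ _ ⟩
  ∑ M (λ c → ∑ R (λ r → seconds r c)) + (∑ M (λ c → ∑ R (λ r → earlier r c)) + ∑ M (λ c → ∑ R (λ r → firsts r c)))
    ≤⟨ +-mono-≤ after (≤-reflexive (sym both)) ⟩
  countBefore U (i + 2) x + countBefore U i M ∎
  where
  open ≤-Reasoning
  M R : ℕ
  M = width U
  R = length U
  firsts seconds earlier : ℕ → ℕ → ℕ
  firsts  r c = 𝟙 (not (c <ᵇ x) ∧ isJust≡ (entry U r c) i)
  earlier r c = 𝟙 ((c <ᵇ x) ∧ isJust≡ (entry U r c) i)
  seconds r c = 𝟙 ((c <ᵇ x) ∧ isJust≡ (entry U r c) (i + 2))

  rearrange : ∀ p q e → (p + q) + e ≡ q + (e + p)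
  rearrange p q e = trans (cong (_+ e) (+-comm p q)) (trans (+-assoc q p e) (cong (q +_) (+-comm p e)))

  bounds : ∀ {r c v} → entry U r c ≡ just v → r < R × c < M
  bounds {r} e = entry⇒row< U r e , <-≤-trans (entry⇒< U r e) (rowLength≤width U r)

  bound₁ : ∀ ps → All (ValidPair U i) ps → All (λ q → proj₁ q < R × proj₂ q < M) (map proj₁ ps)
  bound₁ []       []                  = []
  bound₁ (_ ∷ ps) ((e , _ , _) ∷ val) = bounds e ∷ bound₁ ps val

  bound₂ : ∀ ps → All (ValidPair U i) ps → All (λ q → proj₁ q < R × proj₂ q < M) (map proj₂ ps)
  bound₂ []       []                  = []
  bound₂ (_ ∷ ps) ((_ , e , _) ∷ val) = bounds e ∷ bound₂ ps val

  -- Since the second column weakly precedes the first, no pair has both its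
  -- first square before x and its second square after x.
  cover₁ : ∀ {r₁ c₁ r₂ c₂} → ValidPair U i ((r₁ , c₁) , (r₂ , c₂)) → 1 ≤ firsts r₁ c₁ + seconds r₂ c₂
  cover₁ {r₁} {c₁} {r₂} {c₂} (e₁ , e₂ , _ , c₂≤c₁) with c₁ <? x
  ... | no  c₁≮x = ≤-trans
    (≤-reflexive (sym (cong₂ (λ b e → 𝟙 (not b ∧ e)) (<ᵇ-false (≮⇒≥ c₁≮x)) (isJust≡-complete e₁))))
    (m≤m+n (firsts r₁ c₁) (seconds r₂ c₂))
  ... | yes c₁<x = ≤-trans
    (≤-reflexive (sym (cong₂ (λ b e → 𝟙 (b ∧ e)) (<ᵇ-true (≤-<-trans c₂≤c₁ c₁<x)) (isJust≡-complete e₂))))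
    (m≤n+m (seconds r₂ c₂) (firsts r₁ c₁))

  cover : ∀ ps → All (ValidPair U i) ps → length ps ≤ total firsts (map proj₁ ps) + total seconds (map proj₂ ps)
  cover []       []          = z≤n
  cover (((r₁ , c₁) , (r₂ , c₂)) ∷ ps) (val ∷ vals) = ≤-trans
    (+-mono-≤ (cover₁ val) (cover ps vals))
    (≤-reflexive (+-interchange (firsts r₁ c₁) (seconds r₂ c₂) _ _))

  before : countBefore U i x ≤ ∑ M (λ c → ∑ R (λ r → earlier r c))
  before = ≤-trans (∑-mono x λ c c<x → ∑-mono R λ r _ → ≤-reflexive
      (cong (λ b → 𝟙 (b ∧ isJust≡ (entry U r c) i)) (sym (<ᵇ-true c<x))))
    (∑-≤-support x λ c M≤c → ∑-zero R λ r _ → trans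
      (cong (λ b → 𝟙 ((c <ᵇ x) ∧ b)) (isJust≡-false λ e → ≤⇒≯ M≤c (proj₂ (bounds e))))
      (cong 𝟙 (∧-zeroʳ (c <ᵇ x))))

  after : ∑ M (λ c → ∑ R (λ r → seconds r c)) ≤ countBefore U (i + 2) x
  after = ≤-trans
    (∑-≤-support M {x} λ c x≤c → ∑-zero R λ r _ →
      cong (λ b → 𝟙 (b ∧ isJust≡ (entry U r c) (i + 2))) (<ᵇ-false x≤c))
    (∑-mono x λ c c<x → ∑-mono R λ r _ → ≤-reflexive
      (cong (λ b → 𝟙 (b ∧ isJust≡ (entry U r c) (i + 2))) (<ᵇ-true c<x)))

  both : countBefore U i M ≡ ∑ M (λ c → ∑ R (λ r → earlier r c)) + ∑ M (λ c → ∑ R (λ r → firsts r c))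
  both = trans
    (∑-cong M λ c → trans (∑-cong R λ r → 𝟙-split (c <ᵇ x) (isJust≡ (entry U r c) i)) (∑-+ R _ _))
    (∑-+ M _ _)

-- A maximal matching by scanning columns

module Greedy {U : Tableau} (S : IsSSYT U) (i : ℕ) where

  private
    u w : ℕ → ℕ
    u = countBefore U i
    w = countBefore U (i + 2)

    PosBefore : ℕ → Pos → Set
    PosBefore x q = proj₂ q < x

  -- Reading columns from left to right, every i is paired with some earlier
  -- unpaired i + 2 if there is one.  The cut is the column after the last i that
  -- found none; together with the columns read it certifies maximality.
  record Matching (x₁ x₂ : ℕ) : Set where
    field
      matched   : List (Pos × Pos)
      unmatched : List Pos
      valid     : All (ValidPair U i) matched
      waiting   : All (λ q → entry U (proj₁ q) (proj₂ q) ≡ just (i + 2)) unmatched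
      before₁   : All (PosBefore x₁) (map proj₁ matched)
      before₂   : All (PosBefore x₂) (unmatched ++ map proj₂ matched)
      unique₁   : Unique (map proj₁ matched)
      unique₂   : Unique (unmatched ++ map proj₂ matched)
      scanned   : length unmatched + length matched ≡ w x₂
      cut       : ∃ λ y → w y + u x₁ ≤ length matched + u y

  open Matching

  -- If the `i` were strictly lower, the entry above it in the row of the `i + 2` would be less than
  -- `i`, although it stands weakly to the right of `i + 2`.
  row-≤ : ∀ {r₁ c₁ r₂ c₂} → entry U r₁ c₁ ≡ just i → entry U r₂ c₂ ≡ just (i + 2) → c₂ ≤ c₁ → r₁ ≤ r₂
  row-≤ {r₁} {c₁} {r₂} {c₂} e₁ e₂ c₂≤c₁ with r₁ ≤? r₂
  ... | yes r₁≤r₂ = r₁≤r₂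
  ... | no  r₁≰r₂ with entry-above S (≰⇒> r₁≰r₂) e₁
  ...   | x , e , x<i = contradiction (≤-<-trans (row-mono S c₂≤c₁ e₂ e) x<i) (≤⇒≯ (m≤m+n i 2))

  earlier≢ : ∀ {x r} {qs : List Pos} → All (PosBefore x) qs → All ((r , x) ≢_) qs
  earlier≢ = All.map λ { q<x refl → n≮n _ q<x }

  -- In each column the `i + 2` is read before the `i`, because a pair may lie within one column.
  push : ∀ {x} → Matching x x → Matching x (suc x)
  push {x} m with columnCount U (i + 2) x in eq
  ... | zero = record
    { matched = matched m ; unmatched = unmatched m ; valid = valid m ; waiting = waiting m
    ; before₁ = before₁ m ; before₂ = All.map m<n⇒m<1+n (before₂ m)
    ; unique₁ = unique₁ m ; unique₂ = unique₂ m
    ; scanned = trans (scanned m) (sym (trans (cong (w x +_) eq) (+-identityʳ (w x))))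
    ; cut     = cut m
    }
  ... | suc k with columnCount⇒entry U (subst (1 ≤_) (sym eq) (s≤s (z≤n {k})))
  ...   | r , e = record
    { matched = matched m ; unmatched = (r , x) ∷ unmatched m ; valid = valid m ; waiting = e ∷ waiting m
    ; before₁ = before₁ m ; before₂ = n<1+n x ∷ All.map m<n⇒m<1+n (before₂ m)
    ; unique₁ = unique₁ m ; unique₂ = earlier≢ (before₂ m) ∷ unique₂ m
    ; scanned = trans (cong suc (scanned m)) (trans (+-comm 1 (w x))
        (cong (w x +_) (≤-antisym (entry⇒columnCount U e) (columnCount-≤1 S))))
    ; cut     = cut m
    }

  pop : ∀ {x} → Matching x (suc x) → Matching (suc x) (suc x)
  pop {x} m with columnCount U i x in eq
  ... | zero = record
    { matched = matched m ; unmatched = unmatched m ; valid = valid m ; waiting = waiting m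
    ; before₁ = All.map m<n⇒m<1+n (before₁ m) ; before₂ = before₂ m
    ; unique₁ = unique₁ m ; unique₂ = unique₂ m ; scanned = scanned m
    ; cut     = proj₁ (cut m) , subst (λ n → w (proj₁ (cut m)) + n ≤ _)
        (sym (trans (cong (u x +_) eq) (+-identityʳ (u x)))) (proj₂ (cut m))
    }
  ... | suc k with columnCount⇒entry U (subst (1 ≤_) (sym eq) (s≤s (z≤n {k})))
  pop {x} m@record { unmatched = [] } | suc k | r , e = record
    { matched = matched m ; unmatched = [] ; valid = valid m ; waiting = []
    ; before₁ = All.map m<n⇒m<1+n (before₁ m) ; before₂ = before₂ m
    ; unique₁ = unique₁ m ; unique₂ = unique₂ m ; scanned = scanned m
    -- Nothing is waiting, so every `i + 2` read is matched and the inequality holds with equality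
    -- at the new cut.
    ; cut     = suc x , +-monoˡ-≤ (u (suc x)) (≤-reflexive (sym (scanned m)))
    }
  pop {x} m@record { unmatched = (s , d) ∷ qs ; before₂ = d≤x ∷ _ ; waiting = es ∷ _ } | suc k | r , e = record
    { matched = ((r , x) , (s , d)) ∷ matched m ; unmatched = qs
    ; valid   = (e , es , row-≤ e es (s≤s⁻¹ d≤x) , s≤s⁻¹ d≤x) ∷ valid m
    ; waiting = All.tail (waiting m)
    ; before₁ = n<1+n x ∷ All.map m<n⇒m<1+n (before₁ m)
    -- The matched `i + 2` moves from the front of the waiting list to the front of the second
    -- components, which only permutes the concatenation.
    ; before₂ = All-resp-↭ (↭-sym (shift (s , d) qs (map proj₂ (matched m)))) (before₂ m)
    ; unique₁ = earlier≢ (before₁ m) ∷ unique₁ m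
    ; unique₂ = Unique-resp-↭ (↭⇒↭ₛ (↭-sym (shift (s , d) qs (map proj₂ (matched m))))) (unique₂ m)
    ; scanned = trans (+-suc (length qs) (length (matched m))) (scanned m)
    -- The old cut survives: the matching gains one pair while a column adds at most one `i`.
    ; cut     = proj₁ (cut m) , (begin
        w (proj₁ (cut m)) + (u x + columnCount U i x)
          ≤⟨ +-monoʳ-≤ (w (proj₁ (cut m))) (+-monoʳ-≤ (u x) (columnCount-≤1 S)) ⟩
        w (proj₁ (cut m)) + (u x + 1)
          ≡⟨ +-assoc (w (proj₁ (cut m))) (u x) 1 ⟨
        (w (proj₁ (cut m)) + u x) + 1
          ≤⟨ +-monoˡ-≤ 1 (proj₂ (cut m)) ⟩
        (length (matched m) + u (proj₁ (cut m))) + 1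
          ≡⟨ +-comm (length (matched m) + u (proj₁ (cut m))) 1 ⟩
        suc (length (matched m) + u (proj₁ (cut m))) ∎)
    }
    where open ≤-Reasoning

  match : ∀ x → Matching x x
  match zero = record
    { matched = [] ; unmatched = [] ; valid = [] ; waiting = [] ; before₁ = [] ; before₂ = []
    ; unique₁ = [] ; unique₂ = [] ; scanned = refl ; cut = 0 , ≤-refl }
  match (suc x) = pop (push (match x))

  -- Hall's inequality is needed only at the cut, where cancelling the `i` before it leaves the size
  -- of the greedy matching.
  Hall⇒pairs : ∀ {a} → Hall a U i (i + 2) →
    Σ (List (Pos × Pos)) λ ps →
      a ≤ length ps × All (ValidPair U i) ps × Unique (map proj₁ ps) × Unique (map proj₂ ps)
  Hall⇒pairs {a} hall = matched m , a≤ , valid m , unique₁ m , uniqueʳ (unmatched m) (unique₂ m)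
    where
    open ≤-Reasoning
    m : Matching (width U) (width U)
    m = match (width U)
    y : ℕ
    y = proj₁ (cut m)
    a≤ : a ≤ length (matched m)
    a≤ = +-cancelʳ-≤ (u y) a (length (matched m)) (≤-trans (hall y) (proj₂ (cut m)))
    uniqueʳ : ∀ (xs : List Pos) {ys} → Unique (xs ++ ys) → Unique ys
    uniqueʳ []       uniq       = uniq
    uniqueʳ (_ ∷ xs) (_ ∷ uniq) = uniqueʳ xs uniq

-- Shuffle diagrams

-- Unlike `2 *_`, this unfolds by two successors, in step with `half` and `odd`.
double : ℕ → ℕ
double zero    = zero
double (suc n) = suc (suc (double n))

2*≡double : ∀ n → 2 * n ≡ double n
2*≡double zero    = refl
2*≡double (suc n) = cong suc (trans (+-suc n (n + 0)) (cong suc (2*≡double n)))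

odd-double : ∀ n → odd (double n) ≡ false
odd-double zero    = refl
odd-double (suc n) = odd-double n

odd-1+double : ∀ n → odd (suc (double n)) ≡ true
odd-1+double zero    = refl
odd-1+double (suc n) = odd-1+double n

half-double : ∀ n → half (double n) ≡ n
half-double zero    = refl
half-double (suc n) = cong suc (half-double n)

double-mono-≤ : ∀ {m n} → m ≤ n → double m ≤ double n
double-mono-≤ z≤n       = z≤n
double-mono-≤ (s≤s m≤n) = s≤s (s≤s (double-mono-≤ m≤n))

-- Rows of the diagram start at 1: `1+2* k` and `2+2* k` hold row `k + 1` of the first and of the
-- second skew shape.
data Parity : ℕ → Set where
  1+2* : ∀ k → Parity (suc (double k))
  2+2* : ∀ k → Parity (suc (suc (double k)))

parity : ∀ {i} → 1 ≤ i → Parity i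
parity {1}                 _ = 1+2* 0
parity {2}                 _ = 2+2* 0
parity {suc (suc (suc i))} _ with parity {suc i} (s≤s z≤n)
... | 1+2* k = 1+2* (suc k)
... | 2+2* k = 2+2* (suc k)

countUpTo-false : ∀ {f : ℕ → Bool} n → (∀ k → f k ≡ false) → countUpTo f n ≡ 0
countUpTo-false zero    f≗0 = refl
countUpTo-false (suc n) f≗0 = cong₂ _+_ (cong 𝟙 (f≗0 (suc n))) (countUpTo-false n f≗0)

countUpTo-odds : ∀ {f g : ℕ → Bool} n → (∀ j → f (suc (double j)) ≡ g (suc j)) →
                 (∀ j → f (suc (suc (double j))) ≡ false) → countUpTo f (double n) ≡ countUpTo g n
countUpTo-odds zero    odds evens = refl
countUpTo-odds (suc n) odds evens rewrite evens n | odds n = cong (_ +_) (countUpTo-odds n odds evens)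

countUpTo-evens : ∀ {f g : ℕ → Bool} n → (∀ j → f (suc (double j)) ≡ false) →
                  (∀ j → f (suc (suc (double j))) ≡ g (suc j)) → countUpTo f (double n) ≡ countUpTo g n
countUpTo-evens zero    odds evens = refl
countUpTo-evens (suc n) odds evens rewrite evens n | odds n = cong (_ +_) (countUpTo-evens n odds evens)

module _ {ℓ} (α β γ δ : Vec ℕ ℓ) where

  inShuffle-odd-odd : ∀ k j → inShuffle α β γ δ (suc (double k)) (suc (double j)) ≡ inSkew α β (suc k) (suc j)
  inShuffle-odd-odd k j rewrite odd-1+double k | odd-1+double j | half-double k | half-double j = refl

  inShuffle-odd-even : ∀ k j → inShuffle α β γ δ (suc (double k)) (suc (suc (double j))) ≡ false
  inShuffle-odd-even k j rewrite odd-1+double k | odd-double j = refl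

  inShuffle-even-odd : ∀ k j → inShuffle α β γ δ (suc (suc (double k))) (suc (double j)) ≡ false
  inShuffle-even-odd k j rewrite odd-double k | odd-1+double j = refl

  inShuffle-even-even : ∀ k j → inShuffle α β γ δ (suc (suc (double k))) (suc (suc (double j))) ≡ inSkew γ δ (suc k) (suc j)
  inShuffle-even-even k j rewrite odd-double k | odd-double j | half-double k | half-double j = refl

  halfBound : ℕ
  halfBound = suc (sum (toList α) + sum (toList γ))

  colBound≡double : colBound α β γ δ ≡ double halfBound
  colBound≡double = trans (+-comm (2 * (sum (toList α) + sum (toList γ))) 2) (cong (suc ∘ suc) (2*≡double _))

  rowSize-odd : ∀ k → rowSize α β γ δ (suc (double k)) ≡ countUpTo (inSkew α β (suc k)) halfBound
  rowSize-odd k rewrite colBound≡double =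
    countUpTo-odds {inShuffle α β γ δ (suc (double k))} halfBound (inShuffle-odd-odd k) (inShuffle-odd-even k)

  rowSize-even : ∀ k → rowSize α β γ δ (suc (suc (double k))) ≡ countUpTo (inSkew γ δ (suc k)) halfBound
  rowSize-even k rewrite colBound≡double =
    countUpTo-evens {inShuffle α β γ δ (suc (suc (double k)))} halfBound (inShuffle-even-odd k) (inShuffle-even-even k)

  aCoef-odd : ∀ k → aCoef α β γ δ (suc (double k)) ≡
    countUpTo (λ j → inSkew α β (suc k) j ∧ inSkew α β (suc (suc k)) j) halfBound
  aCoef-odd k rewrite colBound≡double | +-comm (double k) 2 = countUpTo-odds
    {λ C → inShuffle α β γ δ (suc (double k)) C ∧ inShuffle α β γ δ (suc (double (suc k))) C} halfBound
    (λ j → cong₂ _∧_ (inShuffle-odd-odd k j) (inShuffle-odd-odd (suc k) j))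
    (λ j → cong₂ _∧_ (inShuffle-odd-even k j) (inShuffle-odd-even (suc k) j))

  aCoef-even : ∀ k → aCoef α β γ δ (suc (suc (double k))) ≡
    countUpTo (λ j → inSkew γ δ (suc k) j ∧ inSkew γ δ (suc (suc k)) j) halfBound
  aCoef-even k rewrite colBound≡double | +-comm (double k) 2 = countUpTo-evens
    {λ C → inShuffle α β γ δ (suc (suc (double k))) C ∧ inShuffle α β γ δ (suc (suc (double (suc k)))) C} halfBound
    (λ j → cong₂ _∧_ (inShuffle-even-odd k j) (inShuffle-even-odd (suc k) j))
    (λ j → cong₂ _∧_ (inShuffle-even-even k j) (inShuffle-even-even (suc k) j))

module _ {ℓ} (α β γ δ : Vec ℕ ℓ) where

  halfBound-swap : halfBound α β γ δ ≡ halfBound γ δ α β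
  halfBound-swap = cong suc (+-comm (sum (toList α)) (sum (toList γ)))

  rowSize-swap : ∀ k → rowSize α β γ δ (suc (double k)) ≡ rowSize γ δ α β (suc (suc (double k)))
  rowSize-swap k = trans (rowSize-odd α β γ δ k)
    (trans (cong (countUpTo _) halfBound-swap) (sym (rowSize-even γ δ α β k)))

  aCoef-swap : ∀ k → aCoef α β γ δ (suc (double k)) ≡ aCoef γ δ α β (suc (suc (double k)))
  aCoef-swap k = trans (aCoef-odd α β γ δ k)
    (trans (cong (countUpTo _) halfBound-swap) (sym (aCoef-even γ δ α β k)))

part-beyond : ∀ {ℓ} (α : Vec ℕ ℓ) {k} → ℓ ≤ k → part α (suc k) ≡ 0
part-beyond []      _         = refl
part-beyond (a ∷ α) (s≤s ℓ≤k) = part-beyond α ℓ≤k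

inSkew-beyond : ∀ {ℓ} (α β : Vec ℕ ℓ) {k} → ℓ ≤ k → ∀ j → inSkew α β (suc k) j ≡ false
inSkew-beyond α β ℓ≤k zero    = refl
inSkew-beyond α β ℓ≤k (suc j) rewrite part-beyond α ℓ≤k = ∧-zeroʳ _

module _ {ℓ} (α β γ δ : Vec ℕ ℓ) where

  rowSize-beyond : ∀ {k} → ℓ ≤ k → rowSize α β γ δ (suc (double k)) ≡ 0
  rowSize-beyond {k} ℓ≤k = trans (rowSize-odd α β γ δ k) (countUpTo-false _ (inSkew-beyond α β ℓ≤k))

  -- It is enough that the lower of the two rows, row `k + 2` of the skew shape, lies beyond `ℓ`.
  aCoef-beyond : ∀ {k} → ℓ ≤ suc k → aCoef α β γ δ (suc (double k)) ≡ 0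
  aCoef-beyond {k} ℓ≤1+k = trans (aCoef-odd α β γ δ k) (countUpTo-false _ λ j →
    trans (cong (inSkew α β (suc k) j ∧_) (inSkew-beyond α β ℓ≤1+k j)) (∧-zeroʳ _))

-- Composing the involutions

-- The trace that one involution leaves in the whole composition, in terms of counts. Cleanness is
-- asked of `V`, the tableau in which the walks take place.
record Swapped (U V : Tableau) (i : ℕ) : Set where
  field
    swapped-≤     : ∀ x → countBefore V (suc i) x ≤ countBefore U i x
    swapped-+     : ∀ x → countBefore V i x + countBefore V (suc i) x ≡ countBefore U i x + countBefore U (suc i) x
    swapped-clean : ∀ {x} → Clean V i x → countBefore V (suc i) x ≡ countBefore U i x

  swapped-clean′ : ∀ {x} → Clean V i x → countBefore V i x ≡ countBefore U (suc i) x
  swapped-clean′ {x} clean = +-cancelʳ-≡ (countBefore V (suc i) x) _ _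
    (trans (swapped-+ x) (trans (+-comm (countBefore U i x) _) (cong (countBefore U (suc i) x +_) (sym (swapped-clean clean)))))

  swapped-≥ : ∀ x → countBefore U (suc i) x ≤ countBefore V i x
  swapped-≥ x = +-cancelʳ-≤ (countBefore V (suc i) x) _ _ (≤-trans
    (+-monoʳ-≤ (countBefore U (suc i) x) (swapped-≤ x))
    (≤-reflexive (trans (+-comm (countBefore U (suc i) x) _) (sym (swapped-+ x)))))

open Swapped

Clean-≈ : ∀ {U V i x} → U ≈[ i ] V → U ≈[ suc i ] V → Clean V i x → Clean U i x
Clean-≈ ≈i ≈1+i clean c<x x≤d f f′ = clean c<x x≤d (Free-≈ ≈i ≈1+i f) (Free-≈ ≈i ≈1+i f′)

≈-sym : ∀ {U V v} → U ≈[ v ] V → V ≈[ v ] U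
≈-sym U≈V r c = proj₂ (U≈V r c) , proj₁ (U≈V r c)

≈-trans : ∀ {U V W v} → U ≈[ v ] V → V ≈[ v ] W → U ≈[ v ] W
≈-trans U≈V V≈W r c = proj₁ (V≈W r c) ∘ proj₁ (U≈V r c) , proj₂ (U≈V r c) ∘ proj₂ (V≈W r c)

BK-Swapped : ∀ {U} → IsSSYT U → ∀ i → Swapped U (BK i U) i
BK-Swapped {U} S i = record
  { swapped-≤     = countBefore-BK-≤ U i
  ; swapped-+     = countBefore-BK-+ U i
  -- Free squares stay free, so a line that is clean after the involution was clean before it.
  ; swapped-clean = λ clean → countBefore-BK-clean U i λ c<x x≤d f f′ →
      clean c<x x≤d (Free-BK S i f) (Free-BK S i f′)
  }

Swapped-≈ˡ : ∀ {U U′ V i} → shape U ≡ shape U′ → U ≈[ i ] U′ → U ≈[ suc i ] U′ → Swapped U V i → Swapped U′ V i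
Swapped-≈ˡ sh ≈i ≈1+i s = record
  { swapped-≤     = λ x → ≤-trans (swapped-≤ s x) (≤-reflexive (countBefore-≈ x sh ≈i))
  ; swapped-+     = λ x → trans (swapped-+ s x) (cong₂ _+_ (countBefore-≈ x sh ≈i) (countBefore-≈ x sh ≈1+i))
  ; swapped-clean = λ {x} clean → trans (swapped-clean s clean) (countBefore-≈ x sh ≈i)
  }

Swapped-≈ʳ : ∀ {U V V′ i} → shape V ≡ shape V′ → V ≈[ i ] V′ → V ≈[ suc i ] V′ → Swapped U V i → Swapped U V′ i
Swapped-≈ʳ sh ≈i ≈1+i s = record
  { swapped-≤     = λ x → ≤-trans (≤-reflexive (sym (countBefore-≈ x sh ≈1+i))) (swapped-≤ s x)
  ; swapped-+     = λ x → trans (sym (cong₂ _+_ (countBefore-≈ x sh ≈i) (countBefore-≈ x sh ≈1+i))) (swapped-+ s x)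
  ; swapped-clean = λ {x} clean → trans (sym (countBefore-≈ x sh ≈1+i)) (swapped-clean s (Clean-≈ ≈i ≈1+i clean))
  }

2*+1≡ : ∀ n → 2 * n + 1 ≡ suc (double n)
2*+1≡ n = trans (+-comm (2 * n) 1) (cong suc (2*≡double n))

bkOdd-suc : ∀ n U → bkOdd (suc n) U ≡ bkOdd n (BK (suc (double n)) U)
bkOdd-suc n U rewrite 2*+1≡ n = refl

bkOdd-shape : ∀ n U → shape (bkOdd n U) ≡ shape U
bkOdd-shape zero    U = refl
bkOdd-shape (suc n) U = trans (bkOdd-shape n (BK (2 * n + 1) U)) (shape-BK (2 * n + 1) U)

bkOdd-SSYT : ∀ n {U} → IsSSYT U → IsSSYT (bkOdd n U)
bkOdd-SSYT zero    S = S
bkOdd-SSYT (suc n) S = bkOdd-SSYT n (BK-SSYT S (2 * n + 1) (m≤n+m 1 (2 * n)))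

-- The indices involved are at most `2n - 1`, so only letters up to `2n` are touched.
bkOdd-beyond : ∀ n {U v} → double n < v → bkOdd n U ≈[ v ] U
bkOdd-beyond zero            _   r c = id , id
bkOdd-beyond (suc n) {U} {v} 2n<v = subst (_≈[ v ] U) (sym (bkOdd-suc n U))
  (≈-trans {bkOdd n V} {V} {U} (bkOdd-beyond n (<-trans (n<1+n _) 1+2n<v))
    (BK-other {U} (>⇒≢ 1+2n<v) (>⇒≢ 2n<v)))
  where
  V : Tableau
  V = BK (suc (double n)) U
  1+2n<v : suc (double n) < v
  1+2n<v = <-trans (n<1+n _) 2n<v

-- The involutions act on disjoint pairs of letters. Those applied before the one of index `2k + 1`
-- are absorbed on the left, those applied after it on the right.
bkOdd-Swapped : ∀ n {U} → IsSSYT U → ∀ {k} → k < n → Swapped U (bkOdd n U) (suc (double k))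
bkOdd-Swapped (suc n) {U} S {k} k<1+n rewrite bkOdd-suc n U with k ≟ n
... | yes refl = Swapped-≈ʳ (sym (bkOdd-shape n V))
  (≈-sym {bkOdd n V} {V} (bkOdd-beyond n (n<1+n (double n))))
  (≈-sym {bkOdd n V} {V} (bkOdd-beyond n (m<n⇒m<1+n (n<1+n (double n)))))
  (BK-Swapped S (suc (double n)))
  where
  V : Tableau
  V = BK (suc (double n)) U
... | no  k≢n  = Swapped-≈ˡ (shape-BK (suc (double n)) U)
  (BK-other {U} (<⇒≢ 1+2k<1+2n) (<⇒≢ (m<n⇒m<1+n 1+2k<1+2n)))
  (BK-other {U} (<⇒≢ 2+2k<1+2n) (<⇒≢ (m<n⇒m<1+n 2+2k<1+2n)))
  (bkOdd-Swapped n (BK-SSYT S (suc (double n)) (s≤s z≤n)) k<n)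
  where
  k<n : k < n
  k<n = ≤∧≢⇒< (s≤s⁻¹ k<1+n) k≢n
  2+2k<1+2n : suc (suc (double k)) < suc (double n)
  2+2k<1+2n = s≤s (double-mono-≤ k<n)
  1+2k<1+2n : suc (double k) < suc (double n)
  1+2k<1+2n = <-trans (n<1+n _) 2+2k<1+2n

-- Joins a walk from `x` to a clean line with Hall's inequality there; the two counts at that line
-- cancel.
cancel-middle : ∀ {a x y p q w} → p + x ≤ y + q → a + q ≤ p + w → a + x ≤ y + w
cancel-middle {a} {x} {y} {p} {q} {w} p+x≤ a+q≤ = +-cancelʳ-≤ (q + p) _ _ (begin
  (a + x) + (q + p) ≡⟨ +-interchange a x q p ⟩
  (a + q) + (x + p) ≤⟨ +-mono-≤ a+q≤ (≤-trans (≤-reflexive (+-comm x p)) p+x≤) ⟩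
  (p + w) + (y + q) ≡⟨ +-comm (p + w) (y + q) ⟩
  (y + q) + (p + w) ≡⟨ cong ((y + q) +_) (+-comm p w) ⟩
  (y + q) + (w + p) ≡⟨ +-interchange y q w p ⟩
  (y + w) + (q + p) ∎)
  where open ≤-Reasoning

-- Transfer of Hall's condition and of the content

module _ {U V : Tableau} (S : IsSSYT V) (sh : shape V ≡ shape U) where

  Clean-width : ∀ i → Clean V i (width U)
  Clean-width i = Clean-beyond V i (≤-reflexive (cong sum sh))

  -- The walk follows the free squares of the upper pair of letters, for which equality at `p` is
  -- needed. For the lower pair `swapped-≤` already points in the right direction.
  Hall-above : ∀ {a i} → Swapped U V i → Swapped U V (suc (suc i)) →
               Hall a U i (suc (suc i)) → Hall a V (suc i) (suc (suc (suc i)))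
  Hall-above {a} {i} s s′ hall x with nearest-clean-above S (suc i) x
  ... | p , clean , le = ≤-trans
    (cancel-middle {a} {countBefore V (suc i) x} {countBefore V (suc (suc (suc i))) x}
      {countBefore U (suc (suc i)) p} {countBefore U (i) p} {countBefore U (i) (width U)}
      (≤-trans (≤-trans (≤-reflexive (cong (_+ _) (sym (swapped-clean s′ clean)))) le)
                            (+-monoʳ-≤ _ (swapped-≤ s p)))
                   (hall p))
    -- The last line is clean for every index, so the totals are exchanged exactly.
    (≤-reflexive (cong (countBefore V (suc (suc (suc i))) x +_)
      (trans (sym (swapped-clean s (Clean-width i))) (cong (countBefore V (suc i) ∘ sum) (sym sh)))))

  -- The roles are reversed: equality at `p` is needed for the lower pair of letters, and
  -- `swapped-≥` suffices for the upper pair.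
  Hall-below : ∀ {a i} → Swapped U V i → Swapped U V (suc (suc i)) →
               Hall a U (suc i) (suc (suc (suc i))) → Hall a V i (suc (suc i))
  Hall-below {a} {i} s s′ hall x with nearest-clean-below S i x
  ... | p , clean , le = ≤-trans
    (cancel-middle {a} {countBefore V (i) x} {countBefore V (suc (suc i)) x}
      {countBefore U (suc (suc (suc i))) p} {countBefore U (suc i) p} {countBefore U (suc i) (width U)}
      (≤-trans (+-monoˡ-≤ _ (swapped-≥ s′ p))
                            (≤-trans le (≤-reflexive (cong (countBefore V (suc (suc i)) x +_) (swapped-clean′ s clean)))))
                   (hall p))
    (≤-reflexive (cong (countBefore V (suc (suc i)) x +_)
      (trans (sym (swapped-clean′ s (Clean-width i))) (cong (countBefore V i ∘ sum) (sym sh)))))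

  countEntries-≈ : ∀ {v} → V ≈[ v ] U → countEntries v V ≡ countEntries v U
  countEntries-≈ {v} V≈U = trans (countEntries-countBefore v V)
    (trans (countBefore-≈ (width V) sh V≈U)
    (trans (cong (countBefore U v ∘ sum) sh) (sym (countEntries-countBefore v U))))

  countEntries-low : ∀ {i} → Swapped U V i → countEntries i V ≡ countEntries (suc i) U
  countEntries-low {i} s = trans (countEntries-countBefore i V)
    (trans (cong (countBefore V i ∘ sum) sh)
    (trans (swapped-clean′ s (Clean-width i)) (sym (countEntries-countBefore (suc i) U))))

  countEntries-high : ∀ {i} → Swapped U V i → countEntries (suc i) V ≡ countEntries i U
  countEntries-high {i} s = trans (countEntries-countBefore (suc i) V)
    (trans (cong (countBefore V (suc i) ∘ sum) sh)
    (trans (swapped-clean s (Clean-width i)) (sym (countEntries-countBefore i U))))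

theorem1p4 : ∀ {ℓ} (α β γ δ : Vec ℕ ℓ) →
    IsSkewShape α β → IsSkewShape γ δ →
    (T : Tableau) → Peelable α β γ δ T →
    Peelable γ δ α β (bkOdd ℓ T) × shape (bkOdd ℓ T) ≡ shape T
theorem1p4 {ℓ} α β γ δ _ _ T peel = record
  { ssyt    = ssyt′
  ; content = λ r 1≤r → content′ (parity 1≤r)
  ; pairs   = λ i 1≤i → pairs′ (parity 1≤i)
  } , sh
  where
  open Peelable peel
  T′ : Tableau
  T′ = bkOdd ℓ T
  ssyt′ : IsSSYT T′
  ssyt′ = bkOdd-SSYT ℓ ssyt
  sh : shape T′ ≡ shape T
  sh = bkOdd-shape ℓ T

  content′ : ∀ {r} → Parity r → countEntries r T′ ≡ rowSize γ δ α β r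
  content′ (1+2* k) with k <? ℓ
  ... | yes k<ℓ = trans (countEntries-low ssyt′ sh (bkOdd-Swapped ℓ ssyt k<ℓ))
    (trans (content _ (s≤s z≤n)) (sym (rowSize-swap γ δ α β k)))
  -- Letters above `2ℓ` are untouched, and the corresponding rows of both diagrams are empty.
  ... | no  k≮ℓ = trans (countEntries-≈ ssyt′ sh (bkOdd-beyond ℓ (s≤s (double-mono-≤ (≮⇒≥ k≮ℓ)))))
    (trans (content _ (s≤s z≤n)) (trans (rowSize-beyond α β γ δ (≮⇒≥ k≮ℓ)) (sym (rowSize-beyond γ δ α β (≮⇒≥ k≮ℓ)))))
  content′ (2+2* k) with k <? ℓ
  ... | yes k<ℓ = trans (countEntries-high ssyt′ sh (bkOdd-Swapped ℓ ssyt k<ℓ))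
    (trans (content _ (s≤s z≤n)) (rowSize-swap α β γ δ k))
  ... | no  k≮ℓ = trans (countEntries-≈ ssyt′ sh (bkOdd-beyond ℓ (m<n⇒m<1+n (s≤s (double-mono-≤ (≮⇒≥ k≮ℓ))))))
    (trans (content _ (s≤s z≤n)) (trans (trans (sym (rowSize-swap γ δ α β k)) (rowSize-beyond γ δ α β (≮⇒≥ k≮ℓ)))
                                        (trans (sym (rowSize-beyond α β γ δ (≮⇒≥ k≮ℓ))) (rowSize-swap α β γ δ k))))

  hall : ∀ i → 1 ≤ i → Hall (aCoef α β γ δ i) T i (suc (suc i))
  hall i 1≤i with pairs i 1≤i
  ... | ps , a≤ , valid , uniq₁ , uniq₂ =
    subst (Hall (aCoef α β γ δ i) T i) (+-comm i 2) (pairs⇒Hall {T} a≤ valid uniq₁ uniq₂)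

  Pairs : ℕ → Set
  Pairs i = Σ (List (Pos × Pos)) λ ps →
    aCoef γ δ α β i ≤ length ps × All (ValidPair T′ i) ps × Unique (map proj₁ ps) × Unique (map proj₂ ps)

  fromHall : ∀ i → Hall (aCoef γ δ α β i) T′ i (suc (suc i)) → Pairs i
  fromHall i h = Greedy.Hall⇒pairs ssyt′ i (subst (Hall (aCoef γ δ α β i) T′ i) (+-comm 2 i) h)

  noPairs : ∀ i → aCoef γ δ α β i ≡ 0 → Pairs i
  noPairs i a≡0 = [] , ≤-reflexive a≡0 , [] , [] , []

  pairs′ : ∀ {i} → Parity i → Pairs i
  -- Both involutions, of index `2k + 1` and `2k + 3`, must occur in the composition; if the second
  -- does not, the coefficient is zero.
  pairs′ (1+2* k) with suc k <? ℓ
  ... | yes 1+k<ℓ = fromHall (suc (double k)) (subst (λ a → Hall a T′ (suc (double k)) _) (sym (aCoef-swap γ δ α β k))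
    (Hall-below ssyt′ sh (bkOdd-Swapped ℓ ssyt (<-trans (n<1+n k) 1+k<ℓ)) (bkOdd-Swapped ℓ ssyt 1+k<ℓ)
      (hall _ (s≤s z≤n))))
  ... | no  1+k≮ℓ = noPairs _ (aCoef-beyond γ δ α β (≮⇒≥ 1+k≮ℓ))
  pairs′ (2+2* k) with suc k <? ℓ
  ... | yes 1+k<ℓ = fromHall (suc (suc (double k))) (subst (λ a → Hall a T′ (suc (suc (double k))) _) (aCoef-swap α β γ δ k)
    (Hall-above ssyt′ sh (bkOdd-Swapped ℓ ssyt (<-trans (n<1+n k) 1+k<ℓ)) (bkOdd-Swapped ℓ ssyt 1+k<ℓ)
      (hall _ (s≤s z≤n))))
  ... | no  1+k≮ℓ = noPairs _ (trans (sym (aCoef-swap α β γ δ k)) (aCoef-beyond α β γ δ (≮⇒≥ 1+k≮ℓ)))
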